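{- Let $G$ be a connected cubic graph on $n_G \geq 8$ vertices, let $H$ be a connected $3$-chromatic cubic graph (i.e. $H \in Q_3$), and let $l \geq 1$ be an integer. Then $\chi_=(G \circ^l H) \leq 5$.
   Context: All graphs are finite and simple. A cubic graph is a $3$-regular graph; $Q_3$ denotes the class of connected cubic graphs with chromatic number $3$. A graph $F$ is equitably $k$-colorable if $V(F)$ can be partitioned into $k$ (possibly empty) independent sets $V_1,\dots,V_k$ with $\bigl||V_i|-|V_j|\bigr|\le 1$ for all $i,j$. The equitable chromatic number $\chi_=(F)$ is the smallest integer $k$ such that $F$ is equitably $k$-colorable. The corona $G\circ H$ of graphs $G$ and $H$ is formed from one copy of $G$ and $|V(G)|$ disjoint copies of $H$ by joining the $i$-th vertex of $G$ to every vertex of the $i$-th copy of $H$. The $l$-corona product is defined by $G\circ^1 H = G\circ H$ and $G\circ^l H = (G\circ^{l-1}H)\circ H$ for $l\ge 2$. -}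

module Defs where

open import Level using (0ℓ)
open import Data.Fin using (Fin)
import Data.Fin.Properties as Fin
open import Data.List using (List; allFin; filter; length; map)
open import Data.Nat using (ℕ; zero; suc; _+_; _*_; _≤_; ∣_-_∣)
open import Data.Product using (Σ-syntax; _×_; _,_)
open import Data.Product.Function.NonDependent.Propositional using (_×-↔_)
open import Data.Sum using (_⊎_; inj₁; inj₂)
open import Data.Sum.Function.Propositional using (_⊎-↔_)
open import Function using (_↔_; Inverse)
open import Function.Construct.Composition using (_↔-∘_)
open import Function.Construct.Symmetry using (↔-sym)
open import Function.Properties.Inverse using (Inverse⇒Injection)
open import Relation.Binary using (Rel; Decidable; DecidableEquality; Symmetric)
open import Relation.Binary.Construct.Closure.ReflexiveTransitive using (Star)
open import Relation.Binary.PropositionalEquality using (_≡_; _≢_; sym)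
open import Relation.Nullary using (¬_)
open import Relation.Nullary.Decidable using (_×-dec_)
import Relation.Unary as Unary

-- Finite simple graphs.  Vertex sets are arbitrary types equipped with an
-- enumeration rather than literally Fin n, so that the vertices of a corona
-- can be written as V(G) ⊎ (V(G) × V(H)).
record Graph : Set₁ where
  infix 4 _~_ _~?_
  field
    V        : Set
    order    : ℕ
    finite   : V ↔ Fin order
    _~_      : Rel V 0ℓ
    _~?_     : Decidable _~_
    ~-sym    : Symmetric _~_
    ~-irrefl : ∀ {v} → ¬ (v ~ v)

  _≟ⱽ_ : DecidableEquality V
  _≟ⱽ_ = Fin.inj⇒≟ (Inverse⇒Injection finite)

  vertices : List V
  vertices = map (Inverse.from finite) (allFin order)

  count : {P : Unary.Pred V 0ℓ} → Unary.Decidable P → ℕ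
  count P? = length (filter P? vertices)

  degree : V → ℕ
  degree v = count (v ~?_)

open Graph using (V)

Cubic : Graph → Set
Cubic G = ∀ v → Graph.degree G v ≡ 3

-- The empty graph counts as connected here.
Connected : Graph → Set
Connected G = ∀ u v → Star (Graph._~_ G) u v

module _ (G : Graph) where
  open Graph G using (_~_; count)

  IsProper : ∀ {k} → (V G → Fin k) → Set
  IsProper c = ∀ {u v} → u ~ v → c u ≢ c v

  classSize : ∀ {k} → (V G → Fin k) → Fin k → ℕ
  classSize c i = count (λ v → c v Fin.≟ i)

  -- A partition into k possibly empty independent sets is a proper map to Fin k.
  Colorable : ℕ → Set
  Colorable k = Σ[ c ∈ (V G → Fin k) ] IsProper c

  EquitablyColorable : ℕ → Set
  EquitablyColorable k =
    Σ[ c ∈ (V G → Fin k) ]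
      IsProper c × (∀ i j → ∣ classSize c i - classSize c j ∣ ≤ 1)

IsLeast : (ℕ → Set) → ℕ → Set
IsLeast P k = P k × (∀ j → P j → k ≤ j)

-- χ(G) and χ₌(G) as relations: IsChromaticNumber G k says χ(G) = k, and
-- IsEquitableChromaticNumber G k says χ₌(G) = k.
IsChromaticNumber : Graph → ℕ → Set
IsChromaticNumber G = IsLeast (Colorable G)

IsEquitableChromaticNumber : Graph → ℕ → Set
IsEquitableChromaticNumber G = IsLeast (EquitablyColorable G)

Q₃ : Graph → Set
Q₃ H = Connected H × Cubic H × IsChromaticNumber H 3

-- inj₁ u is the vertex u of G, and inj₂ (u , a) is the vertex a of the copy
-- of H attached to u.
module Corona (G H : Graph) where
  private
    module G = Graph G
    module H = Graph H

  Vertex : Set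
  Vertex = V G ⊎ (V G × V H)

  Adj : Rel Vertex 0ℓ
  Adj (inj₁ u)       (inj₁ v)       = u G.~ v
  Adj (inj₁ u)       (inj₂ (v , _)) = u ≡ v
  Adj (inj₂ (u , _)) (inj₁ v)       = u ≡ v
  Adj (inj₂ (u , a)) (inj₂ (v , b)) = u ≡ v × a H.~ b

  adj? : Decidable Adj
  adj? (inj₁ u)       (inj₁ v)       = u G.~? v
  adj? (inj₁ u)       (inj₂ (v , _)) = u G.≟ⱽ v
  adj? (inj₂ (u , _)) (inj₁ v)       = u G.≟ⱽ v
  adj? (inj₂ (u , a)) (inj₂ (v , b)) = (u G.≟ⱽ v) ×-dec (a H.~? b)

  adj-sym : Symmetric Adj
  adj-sym {inj₁ _} {inj₁ _} e       = G.~-sym e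
  adj-sym {inj₁ _} {inj₂ _} e       = sym e
  adj-sym {inj₂ _} {inj₁ _} e       = sym e
  adj-sym {inj₂ _} {inj₂ _} (p , e) = sym p , H.~-sym e

  adj-irrefl : ∀ {x} → ¬ Adj x x
  adj-irrefl {inj₁ _} e       = G.~-irrefl e
  adj-irrefl {inj₂ _} (_ , e) = H.~-irrefl e

  corona : Graph
  corona = record
    { V        = Vertex
    ; order    = G.order + G.order * H.order
    ; finite   = ↔-sym Fin.+↔⊎ ↔-∘ (G.finite ⊎-↔ (↔-sym Fin.*↔× ↔-∘ (G.finite ×-↔ H.finite)))
    ; _~_      = Adj
    ; _~?_     = adj?
    ; ~-sym    = λ {x} {y} → adj-sym {x} {y}
    ; ~-irrefl = λ {x} → adj-irrefl {x}
    }

infixl 7 _⊚_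
_⊚_ : Graph → Graph → Graph
G ⊚ H = Corona.corona G H

-- The case l = 0 is the convention G ∘⁰ H = G; then l = 1 gives G ⊚ H.
infixl 7 _⊚^[_]_
_⊚^[_]_ : Graph → ℕ → Graph → Graph
G ⊚^[ zero ]  H = G
G ⊚^[ suc l ] H = (G ⊚^[ l ] H) ⊚ H

module Submission where

-- Given a 5-colouring of F with class sizes differing by at most one, V(F) can be cut into rainbow blocks
-- of 5 vertices and of 4 vertices (all colours but one colour k), unless |F| is one of 1, 2, 3, 6, 7, 11.
-- Let H have a 3-colouring with classes A, B, C, A the largest, and let s = |H| + 1.  On a 5-block,
-- colouring the copies of H cyclically (A, B, C get the colours i + 1, i + 2, i + 3 at a vertex of colour
-- i) gives every colour total s.  On a 4-block one does the same cyclically on the four present colours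
-- and then recolours part of each A with k; as s ≤ 5 |A|, this allows every nearly equal distribution of
-- the total 4 s.  Hence the corona inherits a balanced 5-colouring, and its order is at least 16.
--
-- For G itself, 11 is excluded by parity, and a balanced 5-colouring comes from adding the vertices one
-- at a time, as in the proof of the Hajnal–Szemerédi theorem: if class P is too large and L too small, a
-- vertex count gives classes X and Y from which a vertex can move to L.  If no chain of moves leads from
-- P to L, then every vertex of P and of the fifth class Z has exactly one neighbour in each of L, X, Y, so
-- some w in X has all its neighbours in P ∪ Z; w moves to L and one of its neighbours takes its place.

open import Defs
open import Level using (Level; 0ℓ)
open import Data.Bool using (Bool; true; false; if_then_else_)
open import Data.Empty using (⊥-elim)
open import Data.Fin using (Fin; zero; suc; toℕ; punchIn; punchOut; #_; _↑ˡ_; _↑ʳ_; combine; remQuot; funToFin; finToFun)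
open import Data.Fin.Permutation.Components using (transpose; transpose-inverse)
import Data.Fin.Properties as Fin
open import Data.List using (List; []; _∷_; _++_; allFin; drop; filter; length; map; replicate)
open import Data.List.Membership.Propositional using (_∈_; find; lose)
open import Data.List.Membership.Propositional.Properties using (∈-allFin; ∈-++⁻; ∈-filter⁺; ∈-filter⁻; ∈-map⁺)
import Data.List.Properties as List
open import Data.List.Relation.Unary.All using (All; []; _∷_)
import Data.List.Relation.Unary.All as All
open import Data.List.Relation.Unary.AllPairs using ([]; _∷_)
import Data.List.Relation.Unary.AllPairs as AllPairs
open import Data.List.Relation.Unary.Any using (here; there)
import Data.List.Relation.Unary.Any as Any
open import Data.List.Relation.Unary.Unique.DecPropositional using (unique?)
open import Data.List.Relation.Unary.Unique.Propositional using (Unique)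
import Data.List.Relation.Unary.Unique.Propositional.Properties as Unique
open import Data.Nat using (ℕ; zero; suc; _+_; _*_; _∸_; _≤_; _<_; z≤n; s≤s; s≤s⁻¹; ∣_-_∣)
open import Data.Nat.DivMod using (_mod_; _%_; m*n%n≡0)
open import Data.Nat.Properties
import Data.Nat.Properties as ℕ
open import Data.Nat.Tactic.RingSolver using (solve-∀)
open import Data.Product using (Σ-syntax; ∃-syntax; _×_; _,_; proj₁; proj₂)
import Data.Sum as Sum
open import Data.Sum using (_⊎_; inj₁; inj₂)
import Data.Vec.Functional as Vec
import Data.Vec.Functional.Properties as Vec
open import Function using (_∘_; Inverse; id; case_of_)
open import Function.Bundles using (module Injection)
open import Function.Construct.Symmetry using (↔-sym)
open import Function.Properties.Inverse using (Inverse⇒Injection)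
open import Relation.Binary using (Rel; Decidable; DecidableEquality; Symmetric)
open import Relation.Binary.PropositionalEquality
open import Relation.Nullary using (¬_; Dec; yes; no; does; contradiction)
open import Relation.Nullary.Decidable using (dec-true; dec-false; _×-dec_; _→-dec_; ¬?; from-yes; from-no)
import Relation.Nullary.Decidable as Dec
import Relation.Unary as Unary

private variable
  A B : Set
  ℓ ℓ′ : Level

-- Indicators, sums over lists and class sizes.

⟦_⟧ : {P : Set ℓ} → Dec P → ℕ
⟦ d ⟧ = if does d then 1 else 0

⟦⟧-true : {P : Set ℓ} (d : Dec P) → P → ⟦ d ⟧ ≡ 1
⟦⟧-true d h = cong (if_then 1 else 0) (dec-true d h)

⟦⟧-false : {P : Set ℓ} (d : Dec P) → ¬ P → ⟦ d ⟧ ≡ 0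
⟦⟧-false d h = cong (if_then 1 else 0) (dec-false d h)

⟦⟧-cong : {P : Set ℓ} {Q : Set ℓ′} → (P → Q) → (Q → P) → (d : Dec P) (e : Dec Q) → ⟦ d ⟧ ≡ ⟦ e ⟧
⟦⟧-cong f g d (yes h) = ⟦⟧-true d (g h)
⟦⟧-cong f g d (no h)  = ⟦⟧-false d (h ∘ f)

δ : ∀ {n} → Fin n → Fin n → ℕ
δ i j = ⟦ i Fin.≟ j ⟧

δ-refl : ∀ {n} (i : Fin n) → δ i i ≡ 1
δ-refl i = ⟦⟧-true (i Fin.≟ i) refl

δ-≢ : ∀ {n} {i j : Fin n} → i ≢ j → δ i j ≡ 0
δ-≢ {i = i} {j} = ⟦⟧-false (i Fin.≟ j)

infixr 6 ∑
∑ : List A → (A → ℕ) → ℕ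
∑ []       f = 0
∑ (x ∷ xs) f = f x + ∑ xs f

syntax ∑ xs (λ x → e) = ∑[ x ∈ xs ] e

+-interchange : ∀ a b c d → (a + b) + (c + d) ≡ (a + c) + (b + d)
+-interchange = solve-∀

∑-cong : ∀ (xs : List A) {f g} → (∀ {x} → x ∈ xs → f x ≡ g x) → ∑ xs f ≡ ∑ xs g
∑-cong []       h = refl
∑-cong (x ∷ xs) h = cong₂ _+_ (h (here refl)) (∑-cong xs (h ∘ there))

∑-mono : ∀ (xs : List A) {f g} → (∀ {x} → x ∈ xs → f x ≤ g x) → ∑ xs f ≤ ∑ xs g
∑-mono []       h = z≤n
∑-mono (x ∷ xs) h = +-mono-≤ (h (here refl)) (∑-mono xs (h ∘ there))

∑-+ : ∀ (xs : List A) (f g : A → ℕ) → ∑[ x ∈ xs ] (f x + g x) ≡ ∑ xs f + ∑ xs g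
∑-+ []       f g = refl
∑-+ (x ∷ xs) f g = trans (cong (f x + g x +_) (∑-+ xs f g)) (+-interchange (f x) (g x) _ _)

∑-0 : ∀ (xs : List A) → ∑[ x ∈ xs ] 0 ≡ 0
∑-0 []       = refl
∑-0 (x ∷ xs) = ∑-0 xs

∑-const : ∀ (xs : List A) k → ∑[ x ∈ xs ] k ≡ length xs * k
∑-const []       k = refl
∑-const (x ∷ xs) k = cong (k +_) (∑-const xs k)

∑-* : ∀ k (xs : List A) (f : A → ℕ) → ∑[ x ∈ xs ] k * f x ≡ k * ∑ xs f
∑-* k []       f = sym (*-zeroʳ k)
∑-* k (x ∷ xs) f = trans (cong (k * f x +_) (∑-* k xs f)) (sym (*-distribˡ-+ k (f x) _))

∑-swap : ∀ (xs : List A) (ys : List B) (f : A → B → ℕ) →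
         ∑[ x ∈ xs ] ∑[ y ∈ ys ] f x y ≡ ∑[ y ∈ ys ] ∑[ x ∈ xs ] f x y
∑-swap []       ys f = sym (∑-0 ys)
∑-swap (x ∷ xs) ys f = trans (cong (∑ ys (f x) +_) (∑-swap xs ys f)) (sym (∑-+ ys (f x) _))

∑-++ : ∀ (xs ys : List A) f → ∑ (xs ++ ys) f ≡ ∑ xs f + ∑ ys f
∑-++ []       ys f = refl
∑-++ (x ∷ xs) ys f = trans (cong (f x +_) (∑-++ xs ys f)) (sym (+-assoc (f x) _ _))

∑-map : ∀ (g : A → B) xs f → ∑ (map g xs) f ≡ ∑ xs (f ∘ g)
∑-map g []       f = refl
∑-map g (x ∷ xs) f = cong (f (g x) +_) (∑-map g xs f)

∑-filter : ∀ {P : A → Set ℓ} (P? : Unary.Decidable P) xs f →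
           ∑ (filter P? xs) f ≡ ∑[ x ∈ xs ] ⟦ P? x ⟧ * f x
∑-filter P? []       f = refl
∑-filter P? (x ∷ xs) f with does (P? x)
... | true  = cong₂ _+_ (sym (+-identityʳ (f x))) (∑-filter P? xs f)
... | false = ∑-filter P? xs f

length-filter : ∀ {P : A → Set ℓ} (P? : Unary.Decidable P) xs → length (filter P? xs) ≡ ∑[ x ∈ xs ] ⟦ P? x ⟧
length-filter P? []       = refl
length-filter P? (x ∷ xs) with does (P? x)
... | true  = cong suc (length-filter P? xs)
... | false = length-filter P? xs

∑-positive : ∀ (xs : List A) f → 1 ≤ ∑ xs f → ∃[ x ] (x ∈ xs × 1 ≤ f x)
∑-positive (x ∷ xs) f h with f x in eq
... | suc _ = x , here refl , subst (1 ≤_) (sym eq) (s≤s z≤n)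
... | zero with ∑-positive xs f h
...   | y , y∈ , hy = y , there y∈ , hy

f≤∑ : ∀ {xs : List A} f {x} → x ∈ xs → f x ≤ ∑ xs f
f≤∑ f (here refl) = m≤m+n _ _
f≤∑ f (there x∈)  = ≤-trans (f≤∑ f x∈) (m≤n+m _ _)

-- Only the single occurrence of `y` in the list has a nonzero indicator.
∑-sift : ∀ {xs : List A} (_≟_ : DecidableEquality A) → Unique xs → ∀ {y} → y ∈ xs → ∀ (f : A → ℕ) →
         ∑[ x ∈ xs ] ⟦ y ≟ x ⟧ * f x ≡ f y
∑-sift {xs = x ∷ xs} _≟_ (x∉ ∷ u) {y} (here refl) f =
  trans (cong₂ _+_ (cong (_* f y) (⟦⟧-true (y ≟ y) refl))
                   (trans (∑-cong xs (λ {z} z∈ → cong (_* f z) (⟦⟧-false (y ≟ z) (All.lookup x∉ z∈)))) (∑-0 xs)))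
        (trans (+-identityʳ _) (+-identityʳ _))
∑-sift {xs = x ∷ xs} _≟_ (x∉ ∷ u) {y} (there y∈) f =
  trans (cong (λ t → t * f x + ∑ xs (λ z → ⟦ y ≟ z ⟧ * f z)) (⟦⟧-false (y ≟ x) (λ e → All.lookup x∉ y∈ (sym e))))
        (∑-sift _≟_ u y∈ f)

cnt : ∀ {k} → (A → Fin k) → Fin k → List A → ℕ
cnt c i xs = ∑[ x ∈ xs ] δ (c x) i

by-class : ∀ {k} (c : A → Fin k) (g : Fin k → ℕ) xs → ∑[ x ∈ xs ] g (c x) ≡ ∑[ i ∈ allFin k ] cnt c i xs * g i
by-class {k = k} c g xs = sym (begin
  ∑[ i ∈ allFin k ] cnt c i xs * g i                  ≡⟨ ∑-cong (allFin k) (λ {i} _ → trans (*-comm _ (g i)) (sym (∑-* (g i) xs _))) ⟩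
  ∑[ i ∈ allFin k ] ∑[ x ∈ xs ] g i * δ (c x) i       ≡⟨ ∑-swap (allFin k) xs _ ⟩
  ∑[ x ∈ xs ] ∑[ i ∈ allFin k ] g i * δ (c x) i       ≡⟨ ∑-cong xs (λ {x} _ → trans (∑-cong (allFin k) (λ {i} _ → *-comm (g i) _)) (∑-sift Fin._≟_ (Unique.allFin⁺ k) (∈-allFin (c x)) g)) ⟩
  ∑[ x ∈ xs ] g (c x)                                 ∎)
  where open ≡-Reasoning

∑-δ≤1 : ∀ {k} {is : List (Fin k)} → Unique is → ∀ j → ∑[ i ∈ is ] δ j i ≤ 1
∑-δ≤1 {is = []}     []       j = z≤n
∑-δ≤1 {is = i ∷ is} (i∉ ∷ u) j with j Fin.≟ i
... | no  _    = ∑-δ≤1 u j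
... | yes refl = ≤-reflexive (cong suc (trans (∑-cong is (λ i′∈ → δ-≢ (All.lookup i∉ i′∈))) (∑-0 is)))

∑-cnt≤length : ∀ {k} (c : A → Fin k) {is} → Unique is → ∀ xs → ∑[ i ∈ is ] cnt c i xs ≤ length xs
∑-cnt≤length c {is} u xs = begin
  ∑[ i ∈ is ] cnt c i xs            ≡⟨ ∑-swap is xs _ ⟩
  ∑[ x ∈ xs ] ∑[ i ∈ is ] δ (c x) i ≤⟨ ∑-mono xs (λ {x} _ → ∑-δ≤1 u (c x)) ⟩
  ∑[ x ∈ xs ] 1                     ≡⟨ trans (∑-const xs 1) (*-identityʳ _) ⟩
  length xs                         ∎
  where open ≤-Reasoning

-- Changing a colouring at one vertex.

module Recolour {V : Set} (_≟_ : DecidableEquality V) where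

  infixl 30 _[_≔_]
  _[_≔_] : (V → A) → V → A → V → A
  (c [ x ≔ k ]) v = if does (v ≟ x) then k else c v

  ≔-same : ∀ (c : V → A) x k → (c [ x ≔ k ]) x ≡ k
  ≔-same c x k = cong (if_then k else c x) (dec-true (x ≟ x) refl)

  ≔-other : ∀ (c : V → A) {x} k {v} → v ≢ x → (c [ x ≔ k ]) v ≡ c v
  ≔-other c {x} k {v} v≢x = cong (if_then k else c v) (dec-false (v ≟ x) v≢x)

  cnt-≔-∉ : ∀ {n} (c : V → Fin n) {x} k i {xs} → All (x ≢_) xs → cnt (c [ x ≔ k ]) i xs ≡ cnt c i xs
  cnt-≔-∉ c k i {xs} x∉ = ∑-cong xs (λ v∈ → cong (λ j → δ j i) (≔-other c k (λ e → All.lookup x∉ v∈ (sym e))))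

  -- The indicators of the old and the new colour stand on opposite sides, so that no truncated
  -- subtraction occurs. In a list without repetitions exactly one term changes.
  cnt-≔ : ∀ {n} (c : V → Fin n) {x} k i {xs} → Unique xs → x ∈ xs →
          cnt (c [ x ≔ k ]) i xs + δ (c x) i ≡ cnt c i xs + δ k i
  cnt-≔ c {x} k i {_ ∷ xs} (x∉ ∷ _) (here refl) = begin
    δ ((c [ x ≔ k ]) x) i + cnt (c [ x ≔ k ]) i xs + δ (c x) i
      ≡⟨ cong₂ (λ a b → a + b + δ (c x) i) (cong (λ j → δ j i) (≔-same c x k)) (cnt-≔-∉ c k i x∉) ⟩
    δ k i + cnt c i xs + δ (c x) i  ≡⟨ swap₁₃ (δ k i) _ _ ⟩
    δ (c x) i + cnt c i xs + δ k i  ∎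
    where
    open ≡-Reasoning
    swap₁₃ : ∀ a b d → a + b + d ≡ d + b + a
    swap₁₃ = solve-∀
  cnt-≔ c {x} k i {v ∷ xs} (v∉ ∷ u) (there x∈) = begin
    δ ((c [ x ≔ k ]) v) i + cnt (c [ x ≔ k ]) i xs + δ (c x) i
      ≡⟨ +-assoc (δ ((c [ x ≔ k ]) v) i) _ _ ⟩
    δ ((c [ x ≔ k ]) v) i + (cnt (c [ x ≔ k ]) i xs + δ (c x) i)
      ≡⟨ cong₂ _+_ (cong (λ j → δ j i) (≔-other c k (All.lookup v∉ x∈))) (cnt-≔ c k i u x∈) ⟩
    δ (c v) i + (cnt c i xs + δ k i)
      ≡⟨ +-assoc (δ (c v) i) _ _ ⟨
    δ (c v) i + cnt c i xs + δ k i ∎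
    where open ≡-Reasoning

  -- Recolouring with `k` can only take vertices away from the other classes. The list is arbitrary,
  -- so the bound applies to neighbourhoods too.
  cnt-≔-≤ : ∀ {n} (c : V → Fin n) x {k i} → i ≢ k → ∀ xs → cnt (c [ x ≔ k ]) i xs ≤ cnt c i xs
  cnt-≔-≤ c x {k} {i} i≢k xs = ∑-mono xs λ {v} _ → step v
    where
    step : ∀ v → δ ((c [ x ≔ k ]) v) i ≤ δ (c v) i
    step v with does (v ≟ x)
    ... | true  = ≤-trans (≤-reflexive (δ-≢ (i≢k ∘ sym))) z≤n
    ... | false = ≤-refl

cnt-relabel : ∀ {n} (τ τ⁻¹ : Fin n → Fin n) → (∀ k → τ⁻¹ (τ k) ≡ k) → (∀ k → τ (τ⁻¹ k) ≡ k) →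
              ∀ (c : A → Fin n) i xs → cnt (τ ∘ c) i xs ≡ cnt c (τ⁻¹ i) xs
cnt-relabel τ τ⁻¹ l r c i xs = ∑-cong xs λ {x} _ →
  ⟦⟧-cong (λ e → trans (sym (l _)) (cong τ⁻¹ e)) (λ e → trans (cong τ e) (r _)) (τ (c x) Fin.≟ i) (c x Fin.≟ τ⁻¹ i)

-- Moving one unit of class size in a proper 5-colouring with maximum degree 3.

module Balance {V : Set} (_≟_ : DecidableEquality V)
  {_~_ : Rel V 0ℓ} (_~?_ : Decidable _~_) (~-sym : Symmetric _~_) (~-irrefl : ∀ {v} → ¬ (v ~ v)) where

  open Recolour _≟_

  module _ (S : List V) where

    ProperOn : (V → Fin 5) → Set
    ProperOn c = ∀ {u v} → u ∈ S → v ∈ S → u ~ v → c u ≢ c v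

    N : V → List V
    N v = filter (v ~?_) S

    nb : (V → Fin 5) → V → Fin 5 → ℕ
    nb c v i = cnt c i (N v)

    -- The class sizes change as if one vertex went from `P` to `L`, while the colourings may differ
    -- in several places. The additive form lets moves compose by cancellation.
    Shift : Fin 5 → Fin 5 → Rel (V → Fin 5) 0ℓ
    Shift P L c c′ = ∀ i → cnt c′ i S + δ P i ≡ cnt c i S + δ L i

    Shiftable : (V → Fin 5) → Fin 5 → Fin 5 → Set
    Shiftable c P L = ∃[ c′ ] (ProperOn c′ × Shift P L c c′)

    -- A vertex of class `Q` that can be recoloured `W` with the colouring staying proper.
    Free : (V → Fin 5) → Fin 5 → Fin 5 → V → Set
    Free c Q W v = c v ≡ Q × nb c v W ≡ 0

    free? : ∀ c Q W → Dec (Any.Any (Free c Q W) S)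
    free? c Q W = Any.any? (λ v → (c v Fin.≟ Q) ×-dec (nb c v W ℕ.≟ 0)) S

    nb≡0 : ∀ c {v w} k → nb c v k ≡ 0 → w ∈ S → v ~ w → c w ≢ k
    nb≡0 c {v} {w} k h w∈ v~w refl = 1+n≰n (begin
      1               ≡⟨ δ-refl (c w) ⟨
      δ (c w) (c w)   ≤⟨ f≤∑ (λ u → δ (c u) (c w)) (∈-filter⁺ (v ~?_) w∈ v~w) ⟩
      nb c v (c w)    ≡⟨ h ⟩
      0               ∎)
      where open ≤-Reasoning

    nb≥1 : ∀ c {v} k → 1 ≤ nb c v k → ∃[ w ] (w ∈ S × v ~ w × c w ≡ k)
    nb≥1 c {v} k h with ∑-positive (N v) _ h
    ... | w , w∈ , hw with c w Fin.≟ k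
    ...   | yes e = w , proj₁ (∈-filter⁻ (v ~?_) w∈) , proj₂ (∈-filter⁻ (v ~?_) {xs = S} w∈) , e

    ≔-proper : ∀ {c v k} → ProperOn c → nb c v k ≡ 0 → ProperOn (c [ v ≔ k ])
    ≔-proper {c} {v} {k} pr h {a} {b} a∈ b∈ a~b with a ≟ v | b ≟ v
    ... | yes refl | yes refl = contradiction a~b ~-irrefl
    ... | yes refl | no _     = nb≡0 c k h b∈ a~b ∘ sym
    ... | no _     | yes refl = nb≡0 c k h a∈ (~-sym a~b)
    ... | no _     | no _     = pr a∈ b∈ a~b

    ≔-shift : Unique S → ∀ {c v k Q} → v ∈ S → c v ≡ Q → Shift Q k c (c [ v ≔ k ])
    ≔-shift u {c} {v} {k} v∈ refl i = cnt-≔ c k i u v∈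

    shift-trans : ∀ {P Q L c c′ c″} → Shift P Q c c′ → Shift Q L c′ c″ → Shift P L c c″
    shift-trans {P} {Q} {L} {c} {c′} {c″} f g i = +-cancelʳ-≡ (δ Q i) _ _ (begin
      cnt c″ i S + δ P i + δ Q i ≡⟨ swap₂₃ (cnt c″ i S) _ _ ⟩
      cnt c″ i S + δ Q i + δ P i ≡⟨ cong (_+ δ P i) (g i) ⟩
      cnt c′ i S + δ L i + δ P i ≡⟨ swap₂₃ (cnt c′ i S) _ _ ⟩
      cnt c′ i S + δ P i + δ L i ≡⟨ cong (_+ δ L i) (f i) ⟩
      cnt c i S + δ Q i + δ L i  ≡⟨ swap₂₃ (cnt c i S) _ _ ⟩
      cnt c i S + δ L i + δ Q i  ∎)
      where
      open ≡-Reasoning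
      swap₂₃ : ∀ a b d → a + b + d ≡ a + d + b
      swap₂₃ = solve-∀

    shift-gain : ∀ {P L c c′} → P ≢ L → Shift P L c c′ → cnt c′ L S ≡ suc (cnt c L S)
    shift-gain {P} {L} {c} {c′} P≢L sh = begin
      cnt c′ L S          ≡⟨ +-identityʳ _ ⟨
      cnt c′ L S + 0      ≡⟨ cong (cnt c′ L S +_) (δ-≢ P≢L) ⟨
      cnt c′ L S + δ P L  ≡⟨ sh L ⟩
      cnt c L S + δ L L   ≡⟨ trans (cong (cnt c L S +_) (δ-refl L)) (+-comm _ 1) ⟩
      suc (cnt c L S)     ∎
      where open ≡-Reasoning

    shift-keep : ∀ {P L c c′ i} → P ≢ i → L ≢ i → Shift P L c c′ → cnt c′ i S ≡ cnt c i S
    shift-keep {P} {L} {c} {c′} {i} P≢i L≢i sh = +-cancelʳ-≡ 0 _ _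
      (subst₂ (λ a b → cnt c′ i S + a ≡ cnt c i S + b) (δ-≢ P≢i) (δ-≢ L≢i) (sh i))

    -- When the sizes differ by one, interchanging the names of the two colours has the effect of a
    -- move.
    exchange : ∀ {c P L} → ProperOn c → cnt c P S ≡ suc (cnt c L S) → Shiftable c P L
    exchange {c} {P} {L} pr h = transpose P L ∘ c , (λ a b e → pr a b e ∘ injective) , shift
      where
      injective : ∀ {k l} → transpose P L k ≡ transpose P L l → k ≡ l
      injective e = trans (sym (transpose-inverse L P)) (trans (cong (transpose L P) e) (transpose-inverse L P))
      sizes : ∀ i → cnt c (transpose L P i) S + δ P i ≡ cnt c i S + δ L i
      sizes i with i Fin.≟ L
      ... | yes refl rewrite h | δ-refl L | δ-≢ {i = P} {L} (λ e → 1+n≢n (trans (sym h) (cong (λ j → cnt c j S) e))) =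
        trans (+-identityʳ _) (+-comm 1 _)
      ... | no i≢L with i Fin.≟ P
      ...   | yes refl rewrite h | δ-refl P | δ-≢ {i = L} {P} (i≢L ∘ sym) = trans (+-comm _ 1) (sym (+-identityʳ _))
      ...   | no i≢P rewrite δ-≢ {i = P} {i} (i≢P ∘ sym) | δ-≢ {i = L} {i} (i≢L ∘ sym) = refl
      shift : Shift P L c (transpose P L ∘ c)
      shift i = trans (cong (_+ δ P i) (cnt-relabel (transpose P L) (transpose L P)
        (λ _ → transpose-inverse L P) (λ _ → transpose-inverse P L) c i S)) (sizes i)

    edges : (V → Fin 5) → Fin 5 → Fin 5 → ℕ
    edges c Q W = ∑[ v ∈ S ] δ (c v) Q * nb c v W

    -- Double counting of the edges between the two classes.
    edges-sym : ∀ c Q W → edges c Q W ≡ edges c W Q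
    edges-sym c Q W = begin
      edges c Q W ≡⟨ expand Q W ⟩
      ∑[ v ∈ S ] ∑[ w ∈ S ] δ (c v) Q * (⟦ v ~? w ⟧ * δ (c w) W) ≡⟨ ∑-swap S S _ ⟩
      ∑[ w ∈ S ] ∑[ v ∈ S ] δ (c v) Q * (⟦ v ~? w ⟧ * δ (c w) W)
        ≡⟨ ∑-cong S (λ {w} _ → ∑-cong S (λ {v} _ →
             trans (cong (λ t → δ (c v) Q * (t * δ (c w) W)) (⟦⟧-cong ~-sym ~-sym (v ~? w) (w ~? v)))
                   (reverse (δ (c v) Q) ⟦ w ~? v ⟧ (δ (c w) W)))) ⟩
      ∑[ w ∈ S ] ∑[ v ∈ S ] δ (c w) W * (⟦ w ~? v ⟧ * δ (c v) Q) ≡⟨ expand W Q ⟨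
      edges c W Q ∎
      where
      open ≡-Reasoning
      reverse : ∀ a b d → a * (b * d) ≡ d * (b * a)
      reverse = solve-∀
      expand : ∀ Q W → edges c Q W ≡ ∑[ v ∈ S ] ∑[ w ∈ S ] δ (c v) Q * (⟦ v ~? w ⟧ * δ (c w) W)
      expand Q W = ∑-cong S λ {v} _ →
        trans (cong (δ (c v) Q *_) (∑-filter (v ~?_) S _)) (sym (∑-* (δ (c v) Q) S _))

    blocked-≥1 : ∀ {c Q W} → ¬ Any.Any (Free c Q W) S → ∀ {v} → v ∈ S → c v ≡ Q → 1 ≤ nb c v W
    blocked-≥1 {c} {Q} {W} ¬f {v} v∈ e with nb c v W in eq
    ... | zero  = contradiction (lose v∈ (e , eq)) ¬f
    ... | suc _ = s≤s z≤n

    blocked⇒≤edges : ∀ {c Q W} → ¬ Any.Any (Free c Q W) S → cnt c Q S ≤ edges c Q W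
    blocked⇒≤edges {c} {Q} {W} ¬f = ∑-mono S step
      where
      step : ∀ {v} → v ∈ S → δ (c v) Q ≤ δ (c v) Q * nb c v W
      step {v} v∈ with c v Fin.≟ Q
      ... | no  _ = z≤n
      ... | yes e = ≤-trans (blocked-≥1 ¬f v∈ e) (≤-reflexive (sym (+-identityʳ _)))

    edges-bound : ∀ {c W} Qs k → (∀ {w} → w ∈ S → c w ≡ W → ∑[ q ∈ Qs ] nb c w q ≤ k) →
                  ∑[ q ∈ Qs ] edges c W q ≤ k * cnt c W S
    edges-bound {c} {W} Qs k h = begin
      ∑[ q ∈ Qs ] edges c W q                          ≡⟨ ∑-swap Qs S _ ⟩
      ∑[ w ∈ S ] ∑[ q ∈ Qs ] δ (c w) W * nb c w q      ≡⟨ ∑-cong S (λ {w} _ → ∑-* (δ (c w) W) Qs _) ⟩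
      ∑[ w ∈ S ] δ (c w) W * (∑[ q ∈ Qs ] nb c w q)    ≤⟨ ∑-mono S step ⟩
      ∑[ w ∈ S ] k * δ (c w) W                         ≡⟨ ∑-* k S _ ⟩
      k * cnt c W S                                    ∎
      where
      open ≤-Reasoning
      step : ∀ {w} → w ∈ S → δ (c w) W * (∑[ q ∈ Qs ] nb c w q) ≤ k * δ (c w) W
      step {w} w∈ with c w Fin.≟ W
      ... | no  _ = z≤n
      ... | yes e = ≤-trans (≤-reflexive (+-identityʳ _)) (≤-trans (h w∈ e) (≤-reflexive (sym (*-identityʳ k))))

    -- Counts the edges between `W` and the classes in `Qs`: each vertex of these classes, being
    -- unable to move to `W`, has a neighbour there, while a vertex of `W` lies on at most `k` such
    -- edges.
    blocked-bound : ∀ {c W} Qs k → (∀ {q} → q ∈ Qs → ¬ Any.Any (Free c q W) S) →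
                    (∀ {w} → w ∈ S → c w ≡ W → ∑[ q ∈ Qs ] nb c w q ≤ k) →
                    ∑[ q ∈ Qs ] cnt c q S ≤ k * cnt c W S
    blocked-bound {c} {W} Qs k ¬f h = ≤-trans
      (∑-mono Qs λ {q} q∈ → ≤-trans (blocked⇒≤edges (¬f q∈)) (≤-reflexive (edges-sym c q W)))
      (edges-bound Qs k h)

    module _ (S! : Unique S) (Δ≤3 : ∀ {v} → v ∈ S → length (N v) ≤ 3) where

      nb-spread : ∀ c {v} → v ∈ S → ∀ {is} → Unique is → ∑[ i ∈ is ] nb c v i ≤ 3
      nb-spread c {v} v∈ is! = ≤-trans (∑-cnt≤length c is! (N v)) (Δ≤3 v∈)

      ≔-shiftable : ∀ {c Q L} → ProperOn c → Any.Any (Free c Q L) S → Shiftable c Q L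
      ≔-shiftable {c} {Q} {L} pr f with find f
      ... | v , v∈ , cv , h = c [ v ≔ L ] , ≔-proper pr h , ≔-shift S! v∈ cv

      -- The last two conditions keep a vertex of P without neighbours in Z movable to Z after the shift.
      Vacatable : (V → Fin 5) → Fin 5 → Fin 5 → Fin 5 → Set
      Vacatable c P Z L = Σ[ (c′ , _) ∈ Shiftable c Z L ]
        (∀ {v} → c v ≡ P → c′ v ≡ P) × (∀ xs → cnt c′ Z xs ≤ cnt c Z xs)

      step : ∀ {c P Z L} → P ≢ Z → Z ≢ L → ProperOn c → Any.Any (Free c Z L) S → Vacatable c P Z L
      step {c} {P} {Z} {L} P≢Z Z≢L pr f with find f
      ... | z , z∈ , refl , h =
        (c [ z ≔ L ] , ≔-proper pr h , ≔-shift S! z∈ refl) ,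
        (λ e → trans (≔-other c L λ { refl → P≢Z (sym e) }) e) ,
        cnt-≔-≤ c z Z≢L

      -- A vertex of `X` moves to `L`, then one of `Z` moves to `X`. The first move only takes a
      -- vertex out of `X`, so the second is still allowed.
      relay : ∀ {c P Z X L} → P ≢ Z → P ≢ X → Z ≢ X → Z ≢ L → X ≢ L → ProperOn c →
              Any.Any (Free c X L) S → Any.Any (Free c Z X) S → Vacatable c P Z L
      relay {c} {P} {Z} {X} {L} P≢Z P≢X Z≢X Z≢L X≢L pr fx fz with find fx | find fz
      ... | x , x∈ , refl , hx | z , z∈ , refl , hz =
        (c₁ [ z ≔ c x ] , ≔-proper (≔-proper pr hx) (n≤0⇒n≡0 (≤-trans (cnt-≔-≤ c x X≢L (N z)) (≤-reflexive hz))) ,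
          λ i → trans (≔-shift S! z∈ c₁z i) (≔-shift S! x∈ refl i)) ,
        (λ e → trans (≔-other c₁ (c x) λ { refl → P≢Z (sym e) }) (trans (≔-other c L λ { refl → P≢X (sym e) }) e)) ,
        λ xs → ≤-trans (cnt-≔-≤ c₁ z Z≢X xs) (cnt-≔-≤ c x Z≢L xs)
        where
        c₁ = c [ x ≔ L ]
        c₁z : c₁ z ≡ c z
        c₁z = ≔-other c L λ { refl → Z≢X refl }

      vacate-fill : ∀ {c P Z L v} → Vacatable c P Z L → v ∈ S → c v ≡ P → nb c v Z ≡ 0 → Shiftable c P L
      vacate-fill {c} {P} {Z} {v = v} ((c₁ , pr₁ , sh₁) , keep , shrink) v∈ cv h =
        c₁ [ v ≔ Z ] , ≔-proper pr₁ (n≤0⇒n≡0 (≤-trans (shrink (N v)) (≤-reflexive h))) ,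
        λ i → trans (≔-shift S! v∈ (keep cv) i) (sh₁ i)

      private
        -- The summands are the numbers of neighbours of a vertex in `L`, `X`, `Y`, `Z`, `P`. One
        -- neighbour in each of the first three exhausts degree 3; the consequences for `X` and `Z`
        -- are recorded.
        room : ∀ {a b d e f} → 1 ≤ a → 1 ≤ b → 1 ≤ d → a + (b + (d + (e + (f + 0)))) ≤ 3 → b ≡ 1 × e ≡ 0
        room {suc a} {suc b} {suc d} {e} {f} _ _ _ (s≤s h) rewrite +-suc a (b + (suc d + (e + (f + 0)))) with h
        ... | s≤s h′ rewrite +-suc b (d + (e + (f + 0))) | +-suc a (b + (d + (e + (f + 0)))) with h′
        ... | s≤s h″ = cong suc (m+n≡0⇒m≡0 b (m+n≡0⇒n≡0 a z)) , m+n≡0⇒m≡0 e (m+n≡0⇒n≡0 d (m+n≡0⇒n≡0 b (m+n≡0⇒n≡0 a z)))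
          where z = n≤0⇒n≡0 h″

        -- Applied to a vertex with three neighbours in `Z` and `P` together: it has none left in
        -- `L`.
        no-room : ∀ {a t} b d → 3 ≤ t → a + (b + (d + t)) ≤ 3 → a ≡ 0
        no-room {zero}  b d h3 h = refl
        no-room {suc a} {t} b d h3 h = contradiction (begin-strict
          3                     ≤⟨ h3 ⟩
          t                     ≤⟨ m≤n+m t d ⟩
          d + t                 ≤⟨ m≤n+m (d + t) b ⟩
          b + (d + t)           ≤⟨ m≤n+m (b + (d + t)) a ⟩
          a + (b + (d + t))     <⟨ ≤-refl ⟩
          suc a + (b + (d + t)) ≤⟨ h ⟩
          3                     ∎) (<-irrefl refl)
          where open ≤-Reasoning

        crowded : ∀ {z p x m} → z ≡ suc m → p ≡ suc (suc m) → x ≤ suc m → ¬ (z + (p + 0) ≤ 2 * x)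
        crowded {x = x} {m} refl refl hx h = 1+n≰n (≤-trans (≤-reflexive (lemma m)) (≤-trans h (*-monoʳ-≤ 2 hx)))
          where
          lemma : ∀ m → 1 + 2 * (1 + m) ≡ (1 + m) + ((2 + m) + 0)
          lemma = solve-∀

      -- `w` is the only neighbour of `y` in `X`, so its departure opens `X` for `y`.
      nb-detach : ∀ {c w y X L} → w ∈ S → y ~ w → c w ≡ X → X ≢ L → nb c y X ≡ 1 → nb (c [ w ≔ L ]) y X ≡ 0
      nb-detach {c} {w} {y} {L = L} w∈ y~w refl X≢L h = +-cancelʳ-≡ 1 _ _ (begin
        nb (c [ w ≔ L ]) y (c w) + 1               ≡⟨ cong (nb (c [ w ≔ L ]) y (c w) +_) (δ-refl (c w)) ⟨
        nb (c [ w ≔ L ]) y (c w) + δ (c w) (c w)   ≡⟨ cnt-≔ c L (c w) (Unique.filter⁺ (y ~?_) S!) (∈-filter⁺ (y ~?_) w∈ y~w) ⟩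
        nb c y (c w) + δ L (c w)                   ≡⟨ cong₂ _+_ h (δ-≢ (X≢L ∘ sym)) ⟩
        1                                          ∎)
        where open ≡-Reasoning

      module _ {c L X Y Z P} (pr : ProperOn c) {m} (|L| : cnt c L S ≡ m) (|X| : cnt c X S ≤ suc m) (|Z| : cnt c Z S ≡ m ⊎ cnt c Z S ≡ suc m)
               (|P| : cnt c P S ≡ suc (suc m))
               (fX : Any.Any (Free c X L) S) (fY : Any.Any (Free c Y L) S) where

        -- `P` first tries to reach `L` directly or through `X` or `Y`, then through `Z`, and at
        -- last by way of a hub.
        rebalance-two : Unique (L ∷ X ∷ Y ∷ Z ∷ P ∷ []) → Shiftable c P L
        rebalance-two colours!@((L≢X ∷ L≢Y ∷ L≢Z ∷ L≢P ∷ []) ∷ (X≢Y ∷ X≢Z ∷ X≢P ∷ []) ∷ (Y≢Z ∷ Y≢P ∷ []) ∷ (Z≢P ∷ []) ∷ [] ∷ [])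
          with free? c P L | free? c P X | free? c P Y
        ... | yes fP | _      | _      = ≔-shiftable pr fP
        ... | no _   | yes fP | _      =
          proj₁ (relay {L = L} (Z≢P) (X≢Z ∘ sym) (X≢P ∘ sym) (L≢P ∘ sym) (L≢X ∘ sym) pr fX fP)
        ... | no _   | no _   | yes fP =
          proj₁ (relay {L = L} (Z≢P) (Y≢Z ∘ sym) (Y≢P ∘ sym) (L≢P ∘ sym) (L≢Y ∘ sym) pr fY fP)
        ... | no ¬PL | no ¬PX | no ¬PY = stuck |Z|
          where
          PZ-apart : ∀ {p} → p ∈ S → c p ≡ P → nb c p Z ≡ 0
          PZ-apart {p} p∈ cp = proj₂ (room {e = nb c p Z} {f = nb c p P} (blocked-≥1 ¬PL p∈ cp) (blocked-≥1 ¬PX p∈ cp) (blocked-≥1 ¬PY p∈ cp) (nb-spread c p∈ colours!))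

          witness : ∃[ p ] (p ∈ S × c p ≡ P)
          witness with ∑-positive S _ (subst (1 ≤_) (sym |P|) (s≤s z≤n))
          ... | p , p∈ , h with c p Fin.≟ P
          ...   | yes e = p , p∈ , e

          stuck : cnt c Z S ≡ m ⊎ cnt c Z S ≡ suc m → Shiftable c P L
          stuck s with witness
          -- Moving `p` to `Z` leaves `Z` with `m + 1` vertices against `m` in `L`, and the two
          -- names are then interchanged.
          stuck (inj₁ |Z|≡m) | p , p∈ , cp = c₂ , pr₂ , shift-trans {P} {Z} {L} {c} {c [ p ≔ Z ]} {c₂} sh₁ sh₂
            where
            sh₁ = ≔-shift S! {c} {p} {Z} p∈ cp
            ex = exchange {c [ p ≔ Z ]} {Z} {L} (≔-proper pr (PZ-apart p∈ cp))
              (trans (shift-gain {c = c} {c [ p ≔ Z ]} (Z≢P ∘ sym) sh₁) (cong suc (trans |Z|≡m (sym (trans (shift-keep {c = c} {c [ p ≔ Z ]} (L≢P ∘ sym) (L≢Z ∘ sym) sh₁) |L|)))))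
            c₂ = proj₁ ex
            pr₂ = proj₁ (proj₂ ex)
            sh₂ = proj₂ (proj₂ ex)
          stuck (inj₂ |Z|≡1+m) | p , p∈ , cp with free? c Z L | free? c Z X | free? c Z Y
          ...   | yes fZ | _ | _ = vacate-fill {L = L} (step (Z≢P ∘ sym) (L≢Z ∘ sym) pr fZ) p∈ cp (PZ-apart p∈ cp)
          ...   | no _ | yes fZ | _ =
            vacate-fill {L = L} (relay (Z≢P ∘ sym) (X≢P ∘ sym) (X≢Z ∘ sym) (L≢Z ∘ sym) (L≢X ∘ sym) pr fX fZ) p∈ cp (PZ-apart p∈ cp)
          ...   | no _ | no _ | yes fZ =
            vacate-fill {L = L} (relay (Z≢P ∘ sym) (Y≢P ∘ sym) (Y≢Z ∘ sym) (L≢Z ∘ sym) (L≢Y ∘ sym) pr fY fZ) p∈ cp (PZ-apart p∈ cp)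
          ...   | no ¬ZL | no ¬ZX | no ¬ZY = swap-out hub
            where
            PZ-room : ∀ {y} → y ∈ S → c y ≡ Z ⊎ c y ≡ P → nb c y X ≡ 1
            PZ-room {y} y∈ (inj₁ cy) = proj₁ (room {e = nb c y Z} {f = nb c y P} (blocked-≥1 ¬ZL y∈ cy) (blocked-≥1 ¬ZX y∈ cy) (blocked-≥1 ¬ZY y∈ cy) (nb-spread c y∈ colours!))
            PZ-room {y} y∈ (inj₂ cy) = proj₁ (room {e = nb c y Z} {f = nb c y P} (blocked-≥1 ¬PL y∈ cy) (blocked-≥1 ¬PX y∈ cy) (blocked-≥1 ¬PY y∈ cy) (nb-spread c y∈ colours!))

            -- By the degree bound, all neighbours of a hub lie in `Z` and `P`. The `+ 0` matches a
            -- sum over a two-element list.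
            Hub : V → Set
            Hub w = c w ≡ X × 3 ≤ nb c w Z + (nb c w P + 0)

            hub? : ∀ w → Dec (Hub w)
            hub? w = (c w Fin.≟ X) ×-dec (3 ≤? nb c w Z + (nb c w P + 0))

            hub : ∃[ w ] (w ∈ S × Hub w)
            hub with Any.any? hub? S
            ... | yes h = find h
            -- Without a hub at most `2 (m + 1)` edges join `X` to `Z` and `P`, but the `2 m + 3`
            -- vertices of the latter each have a neighbour in `X`.
            ... | no ¬h = contradiction too-many (crowded |Z|≡1+m |P| |X|)
              where
              too-many : cnt c Z S + (cnt c P S + 0) ≤ 2 * cnt c X S
              too-many = blocked-bound (Z ∷ P ∷ []) 2 (λ { (here refl) → ¬ZX ; (there (here refl)) → ¬PX })
                λ {w} w∈ cw → s≤s⁻¹ (≰⇒> λ h → ¬h (lose w∈ (cw , h)))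

            partner : ∀ {w} → w ∈ S → Hub w → ∃[ y ] (y ∈ S × w ~ y × (c y ≡ Z ⊎ c y ≡ P))
            partner {w} w∈ (_ , h) with nb c w Z in eq
            ... | suc _ with nb≥1 c {w} Z (subst (1 ≤_) (sym eq) (s≤s z≤n))
            ...   | y , y∈ , w~y , cy = y , y∈ , w~y , inj₁ cy
            partner {w} w∈ (_ , h) | zero with nb≥1 c {w} P (≤-trans (s≤s z≤n) (≤-trans h (≤-reflexive (+-identityʳ _))))
            ...   | y , y∈ , w~y , cy = y , y∈ , w~y , inj₂ cy

            swap-out : ∃[ w ] (w ∈ S × Hub w) → Shiftable c P L
            swap-out (w , w∈ , h@(cw , h3)) with partner w∈ h
            ... | y , y∈ , w~y , cy = finish cy
              where
              c₁ = c [ w ≔ L ]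
              c₂ = c₁ [ y ≔ X ]
              pr₁ : ProperOn c₁
              pr₁ = ≔-proper pr (no-room (nb c w X) (nb c w Y) h3 (nb-spread c w∈ colours!))
              pr₂ : ProperOn c₂
              pr₂ = ≔-proper pr₁ (nb-detach w∈ (~-sym w~y) cw (L≢X ∘ sym) (PZ-room y∈ cy))
              c₁-keep : ∀ {v} → c v ≢ X → c₁ v ≡ c v
              c₁-keep h = ≔-other c L λ { refl → h cw }
              finish : c y ≡ Z ⊎ c y ≡ P → Shiftable c P L
              finish (inj₂ cy) = c₂ , pr₂ , λ i →
                trans (≔-shift S! y∈ (trans (c₁-keep λ e → X≢P (trans (sym e) cy)) cy) i) (≔-shift S! w∈ cw i)
              -- `y` came from `Z`, so `p` fills its place. Recolouring `w` and `y` added nothing to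
              -- `Z`, hence `p` still has no neighbour there.
              finish (inj₁ cy) = c₂ [ p ≔ Z ] ,
                ≔-proper pr₂ (n≤0⇒n≡0 (≤-trans (cnt-≔-≤ c₁ y (X≢Z ∘ sym) (N p))
                  (≤-trans (cnt-≔-≤ c w (L≢Z ∘ sym) (N p)) (≤-reflexive (PZ-apart p∈ cp))))) ,
                λ i → trans (≔-shift S! p∈ c₂p i) (trans
                  (≔-shift S! y∈ (trans (c₁-keep λ e → X≢Z (trans (sym e) cy)) cy) i) (≔-shift S! w∈ cw i))
                where
                c₂p : c₂ p ≡ P
                c₂p = trans (≔-other c₁ X λ { refl → Z≢P (trans (sym cy) cp) })
                            (trans (c₁-keep λ e → X≢P (trans (sym e) cp)) cp)

      private
        at-most : ∀ {n m} → n ≡ m ⊎ n ≡ suc m → n ≤ suc m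
        at-most (inj₁ refl) = n≤1+n _
        at-most (inj₂ refl) = ≤-refl

        at-least : ∀ {n m} → n ≡ m ⊎ n ≡ suc m → m ≤ n
        at-least (inj₁ refl) = ≤-refl
        at-least (inj₂ refl) = n≤1+n _

      -- Three blocked classes have at least `3 m + 2` vertices, each with a neighbour in `L`, but
      -- the `m` vertices of `L` have degree at most 3.
      two-blocked : ∀ {c L A B P m} → cnt c L S ≡ m → cnt c P S ≡ suc (suc m) → Unique (A ∷ B ∷ P ∷ []) →
                    m ≤ cnt c A S → m ≤ cnt c B S →
                    ¬ Any.Any (Free c A L) S → ¬ Any.Any (Free c B L) S → ¬ ¬ Any.Any (Free c P L) S
      two-blocked {c} {L} {A} {B} {P} {m} |L| |P| u hA hB ¬A ¬B ¬P = 1+n≰n (begin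
        1 + 3 * m                                     ≤⟨ n≤1+n _ ⟩
        2 + 3 * m                                     ≡⟨ lemma m ⟩
        m + (m + (suc (suc m) + 0))                   ≤⟨ +-mono-≤ hA (+-mono-≤ hB (≤-reflexive (cong (_+ 0) (sym |P|)))) ⟩
        ∑[ q ∈ A ∷ B ∷ P ∷ [] ] cnt c q S             ≤⟨ blocked-bound (A ∷ B ∷ P ∷ []) 3
          (λ { (here refl) → ¬A ; (there (here refl)) → ¬B ; (there (there (here refl))) → ¬P })
          (λ w∈ _ → nb-spread c w∈ u) ⟩
        3 * cnt c L S                                 ≡⟨ cong (3 *_) |L| ⟩
        3 * m                                         ∎)
        where
        open ≤-Reasoning
        lemma : ∀ m → 2 + 3 * m ≡ m + (m + (suc (suc m) + 0))
        lemma = solve-∀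

      -- If `P` cannot move to `L` directly, at most one of the three intermediate classes is
      -- blocked. Two unblocked ones act as `X` and `Y`, the third as `Z`.
      rebalance : ∀ {c L Q₁ Q₂ Q₃ P} → ProperOn c → Unique (L ∷ Q₁ ∷ Q₂ ∷ Q₃ ∷ P ∷ []) →
                  ∀ {m} → cnt c L S ≡ m → cnt c P S ≡ suc (suc m) → (∀ {i} → i ≢ P → cnt c i S ≡ m ⊎ cnt c i S ≡ suc m) →
                  Shiftable c P L
      rebalance {c} {L} {Q₁} {Q₂} {Q₃} {P} pr
        ((L≢1 ∷ L≢2 ∷ L≢3 ∷ L≢P ∷ []) ∷ (1≢2 ∷ 1≢3 ∷ 1≢P ∷ []) ∷ (2≢3 ∷ 2≢P ∷ []) ∷ (3≢P ∷ []) ∷ [] ∷ []) {m} |L| |P| sizes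
        with free? c P L | free? c Q₁ L | free? c Q₂ L | free? c Q₃ L
      ... | yes fP | _ | _ | _ = ≔-shiftable pr fP
      ... | _ | yes f₁ | yes f₂ | _ = rebalance-two pr |L| (at-most (sizes 1≢P)) (sizes 3≢P) |P| f₁ f₂
        ((L≢1 ∷ L≢2 ∷ L≢3 ∷ L≢P ∷ []) ∷ (1≢2 ∷ 1≢3 ∷ 1≢P ∷ []) ∷ (2≢3 ∷ 2≢P ∷ []) ∷ (3≢P ∷ []) ∷ [] ∷ [])
      ... | _ | yes f₁ | _ | yes f₃ = rebalance-two pr |L| (at-most (sizes 1≢P)) (sizes 2≢P) |P| f₁ f₃
        ((L≢1 ∷ L≢3 ∷ L≢2 ∷ L≢P ∷ []) ∷ (1≢3 ∷ 1≢2 ∷ 1≢P ∷ []) ∷ ((2≢3 ∘ sym) ∷ 3≢P ∷ []) ∷ (2≢P ∷ []) ∷ [] ∷ [])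
      ... | _ | _ | yes f₂ | yes f₃ = rebalance-two pr |L| (at-most (sizes 2≢P)) (sizes 1≢P) |P| f₂ f₃
        ((L≢2 ∷ L≢3 ∷ L≢1 ∷ L≢P ∷ []) ∷ (2≢3 ∷ (1≢2 ∘ sym) ∷ 2≢P ∷ []) ∷ ((1≢3 ∘ sym) ∷ 3≢P ∷ []) ∷ (1≢P ∷ []) ∷ [] ∷ [])
      ... | no ¬P | no ¬1 | no ¬2 | _ = ⊥-elim (two-blocked |L| |P| ((1≢2 ∷ 1≢P ∷ []) ∷ (2≢P ∷ []) ∷ [] ∷ []) (at-least (sizes 1≢P)) (at-least (sizes 2≢P)) ¬1 ¬2 ¬P)
      ... | no ¬P | no ¬1 | _ | no ¬3 = ⊥-elim (two-blocked |L| |P| ((1≢3 ∷ 1≢P ∷ []) ∷ (3≢P ∷ []) ∷ [] ∷ []) (at-least (sizes 1≢P)) (at-least (sizes 3≢P)) ¬1 ¬3 ¬P)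
      ... | no ¬P | _ | no ¬2 | no ¬3 = ⊥-elim (two-blocked |L| |P| ((2≢3 ∷ 2≢P ∷ []) ∷ (3≢P ∷ []) ∷ [] ∷ []) (at-least (sizes 2≢P)) (at-least (sizes 3≢P)) ¬2 ¬3 ¬P)

-- The balanced class sizes for M vertices are obtained by dealing the vertices cyclically to the colours.

turn : ℕ → Fin 5
turn 0 = # 0
turn 1 = # 1
turn 2 = # 2
turn 3 = # 3
turn 4 = # 4
turn (suc (suc (suc (suc (suc M))))) = turn M

share : ℕ → Fin 5 → ℕ
share zero    i = 0
share (suc M) i = δ (turn M) i + share M i

share-5+ : ∀ M i → share (5 + M) i ≡ suc (share M i)
share-5+ zero    i = from-yes (Fin.all? λ i → share 5 i ℕ.≟ 1) i
share-5+ (suc M) i = trans (cong (δ (turn M) i +_) (share-5+ M i)) (+-suc (δ (turn M) i) _)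

-- `turn M` is the colour about to be dealt, so its share is smallest. Five more vertices raise all
-- shares by one, which leaves five cases.
share-turn : ∀ M i → share M i ≡ share M (turn M) ⊎ share M i ≡ suc (share M (turn M))
share-turn 0 i = inj₁ refl
share-turn 1 i = from-yes (Fin.all? λ i → (share 1 i ℕ.≟ 0) Dec.⊎-dec (share 1 i ℕ.≟ 1)) i
share-turn 2 i = from-yes (Fin.all? λ i → (share 2 i ℕ.≟ 0) Dec.⊎-dec (share 2 i ℕ.≟ 1)) i
share-turn 3 i = from-yes (Fin.all? λ i → (share 3 i ℕ.≟ 0) Dec.⊎-dec (share 3 i ℕ.≟ 1)) i
share-turn 4 i = from-yes (Fin.all? λ i → (share 4 i ℕ.≟ 0) Dec.⊎-dec (share 4 i ℕ.≟ 1)) i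
share-turn (suc (suc (suc (suc (suc M))))) i rewrite share-5+ M i | share-5+ M (turn M) with share-turn M i
... | inj₁ e = inj₁ (cong suc e)
... | inj₂ e = inj₂ (cong suc e)

-- The three colours other than `L` and `punchIn L P`.
others : Fin 5 → Fin 4 → Fin 3 → Fin 5
others L P i = punchIn L (punchIn P i)

others-unique : ∀ L P → Unique (L ∷ others L P (# 0) ∷ others L P (# 1) ∷ others L P (# 2) ∷ punchIn L P ∷ [])
others-unique = from-yes (Fin.all? λ L → Fin.all? λ P →
  unique? Fin._≟_ (L ∷ others L P (# 0) ∷ others L P (# 1) ∷ others L P (# 2) ∷ punchIn L P ∷ []))

other-colours : ∀ {L P : Fin 5} → L ≢ P → ∃[ Q₁ ] ∃[ Q₂ ] ∃[ Q₃ ] Unique (L ∷ Q₁ ∷ Q₂ ∷ Q₃ ∷ P ∷ [])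
other-colours {L} L≢P = q (# 0) , q (# 1) , q (# 2) ,
  subst (λ P → Unique (L ∷ q (# 0) ∷ q (# 1) ∷ q (# 2) ∷ P ∷ [])) (Fin.punchIn-punchOut L≢P) (others-unique L (punchOut L≢P))
  where q = others L (punchOut L≢P)

-- Balanced 5-colourings, built one vertex at a time.

module _ {V : Set} (_≟_ : DecidableEquality V)
  {_~_ : Rel V 0ℓ} (_~?_ : Decidable _~_) (~-sym : Symmetric _~_) (~-irrefl : ∀ {v} → ¬ (v ~ v)) where

  open Recolour _≟_
  open Balance _≟_ _~?_ ~-sym ~-irrefl

  Balanced : List V → (V → Fin 5) → Set
  Balanced S c = ProperOn S c × (∀ i → cnt c i S ≡ share (length S) i)

  -- Three neighbours cannot carry all five colours.
  open-colour : ∀ S c v → length (N S v) ≤ 3 → ∃[ k ] nb S c v k ≡ 0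
  open-colour S c v d with Fin.any? (λ k → nb S c v k ℕ.≟ 0)
  ... | yes h = h
  ... | no ¬h = contradiction (begin
    5                                ≤⟨ ∑-mono (allFin 5) {f = λ _ → 1} (λ {k} _ → n≢0⇒n>0 λ e → ¬h (k , e)) ⟩
    ∑[ k ∈ allFin 5 ] nb S c v k     ≤⟨ ∑-cnt≤length c (Unique.allFin⁺ 5) (N S v) ⟩
    length (N S v)                   ≤⟨ d ⟩
    3                                ∎) (from-no (5 ≤? 3))
    where open ≤-Reasoning

  module _ {x S} (S! : Unique (x ∷ S)) (Δ≤3 : ∀ v → length (N (x ∷ S) v) ≤ 3)
           {c k} (bal : Balanced S c) (xk : nb S c x k ≡ 0) where

    private
      M  = length S
      L  = turn M
      c₁ = c [ x ≔ k ]

      tail : ∀ {v} → v ∈ x ∷ S → v ≢ x → v ∈ S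
      tail (here e)   v≢x = contradiction e v≢x
      tail (there v∈) v≢x = v∈

      proper₁ : ProperOn (x ∷ S) c₁
      proper₁ {a} {b} a∈ b∈ a~b with a ≟ x | b ≟ x
      ... | yes refl | yes refl = contradiction a~b ~-irrefl
      ... | yes refl | no b≢x   = nb≡0 S c k xk (tail b∈ b≢x) a~b ∘ sym
      ... | no a≢x   | yes refl = nb≡0 S c k xk (tail a∈ a≢x) (~-sym a~b)
      ... | no a≢x   | no b≢x   = proj₁ bal (tail a∈ a≢x) (tail b∈ b≢x) a~b

      sizes₁ : ∀ i → cnt c₁ i (x ∷ S) ≡ δ k i + share M i
      sizes₁ i = cong₂ _+_ (cong (λ j → δ j i) (≔-same c x k)) (trans (cnt-≔-∉ c k i (AllPairs.head S!)) (proj₂ bal i))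

      sizes-k : cnt c₁ k (x ∷ S) ≡ suc (share M k)
      sizes-k = trans (sizes₁ k) (cong (_+ share M k) (δ-refl k))

      sizes-≢ : ∀ {i} → i ≢ k → cnt c₁ i (x ∷ S) ≡ share M i
      sizes-≢ {i} i≢k = trans (sizes₁ i) (cong (_+ share M i) (δ-≢ (i≢k ∘ sym)))

      finish : Shiftable (x ∷ S) c₁ k L → ∃[ c′ ] Balanced (x ∷ S) c′
      finish (c′ , pr , sh) = c′ , pr , λ i → +-cancelʳ-≡ (δ k i) _ _
        (trans (sh i) (trans (cong (_+ δ L i) (sizes₁ i)) (rotate (δ k i) (share M i) (δ L i))))
        where
        rotate : ∀ a b d → a + b + d ≡ d + b + a
        rotate = solve-∀

    -- The new vertex enlarges class `k`, whereas balance asks for `L` to grow. If `k` differs from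
    -- `L`, its class now exceeds that of `L` by one or two: interchanging names settles the first
    -- case, `rebalance` the second.
    add-vertex : ∃[ c′ ] Balanced (x ∷ S) c′
    add-vertex with L Fin.≟ k
    ... | yes L≡k = c₁ , proper₁ , subst (λ j → ∀ i → cnt c₁ i (x ∷ S) ≡ δ j i + share M i) (sym L≡k) sizes₁
    ... | no L≢k with share-turn M k
    ...   | inj₁ e = finish (exchange (x ∷ S) proper₁ (trans sizes-k (cong suc (trans e (sym (sizes-≢ L≢k))))))
    ...   | inj₂ e = finish (rebalance (x ∷ S) S! (λ {v} _ → Δ≤3 v) proper₁ (proj₂ (proj₂ (proj₂ (other-colours L≢k))))
      (sizes-≢ L≢k) (trans sizes-k (cong suc e))
      λ {i} i≢k → subst (λ n → n ≡ share M L ⊎ n ≡ suc (share M L)) (sym (sizes-≢ i≢k)) (share-turn M i))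

  balanced-colouring : ∀ {S} → Unique S → (∀ v → length (N S v) ≤ 3) → ∃[ c ] Balanced S c
  balanced-colouring {[]}    []          Δ≤3 = (λ _ → # 0) , (λ ()) , λ _ → refl
  balanced-colouring {x ∷ S} S!@(_ ∷ S!′) Δ≤3 =
    add-vertex S! Δ≤3 (proj₂ IH) (proj₂ (open-colour S (proj₁ IH) x (Δ′ x)))
    where
    Δ′ : ∀ v → length (N S v) ≤ 3
    Δ′ v = ≤-trans (subst₂ _≤_ (sym (length-filter (v ~?_) S)) (sym (length-filter (v ~?_) (x ∷ S))) (m≤n+m _ ⟦ v ~? x ⟧)) (Δ≤3 v)
    IH = balanced-colouring S!′ Δ′

-- Arithmetic of balanced class sizes.

share-5* : ∀ a M i → share (a * 5 + M) i ≡ a + share M i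
share-5* zero    M i = refl
share-5* (suc a) M i = trans (share-5+ (a * 5 + M) i) (cong suc (share-5* a M i))

share-mono : ∀ {M M′} i → M ≤ M′ → share M i ≤ share M′ i
share-mono {M} i M≤M′ with m≤n⇒∃[o]m+o≡n M≤M′
... | o , refl = subst (λ n → share M i ≤ share n i) (+-comm o M) (grow o)
  where
  grow : ∀ o → share M i ≤ share (o + M) i
  grow zero    = ≤-refl
  grow (suc o) = ≤-trans (grow o) (m≤n+m _ _)

∑-δ : ∀ {k} (i : Fin k) → ∑[ j ∈ allFin k ] δ i j ≡ 1
∑-δ {k} i = trans (∑-cong (allFin k) (λ _ → sym (*-identityʳ _)))
                  (∑-sift Fin._≟_ (Unique.allFin⁺ k) (∈-allFin i) (λ _ → 1))

∑-share : ∀ M → ∑[ i ∈ allFin 5 ] share M i ≡ M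
∑-share zero    = refl
∑-share (suc M) = trans (∑-+ (allFin 5) (δ (turn M)) (share M)) (cong₂ _+_ (∑-δ (turn M)) (∑-share M))

share-equitable : ∀ M i j → ∣ share M i - share M j ∣ ≤ 1
share-equitable M i j = ∣-∣≤1 (share-turn M i) (share-turn M j)
  where
  ∣-∣≤1 : ∀ {a b m} → a ≡ m ⊎ a ≡ suc m → b ≡ m ⊎ b ≡ suc m → ∣ a - b ∣ ≤ 1
  ∣-∣≤1 {m = m} (inj₁ refl) (inj₁ refl) = ≤-trans (≤-reflexive (∣n-n∣≡0 m)) z≤n
  ∣-∣≤1 {m = m} (inj₁ refl) (inj₂ refl) = ≤-reflexive (trans (cong ∣ m -_∣ (+-comm 1 m)) (∣m-m+n∣≡n m 1))
  ∣-∣≤1 {m = m} (inj₂ refl) (inj₁ refl) = ≤-reflexive (trans (∣-∣-comm (suc m) m) (trans (cong ∣ m -_∣ (+-comm 1 m)) (∣m-m+n∣≡n m 1)))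
  ∣-∣≤1 {m = m} (inj₂ refl) (inj₂ refl) = ≤-trans (≤-reflexive (∣n-n∣≡0 m)) z≤n

-- Sums over the vertices of a corona.

∑-allFin-suc : ∀ n (f : Fin (suc n) → ℕ) → ∑ (allFin (suc n)) f ≡ f zero + ∑ (allFin n) (f ∘ suc)
∑-allFin-suc n f = cong (f zero +_) (trans (cong (λ xs → ∑ xs f) (sym (List.map-tabulate id suc))) (∑-map suc (allFin n) f))

∑-allFin-+ : ∀ m n (f : Fin (m + n) → ℕ) →
             ∑ (allFin (m + n)) f ≡ (∑[ i ∈ allFin m ] f (i ↑ˡ n)) + (∑[ j ∈ allFin n ] f (m ↑ʳ j))
∑-allFin-+ zero    n f = refl
∑-allFin-+ (suc m) n f = begin
  ∑ (allFin (suc m + n)) f                       ≡⟨ ∑-allFin-suc (m + n) f ⟩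
  f zero + ∑ (allFin (m + n)) (f ∘ suc)          ≡⟨ cong (f zero +_) (∑-allFin-+ m n (f ∘ suc)) ⟩
  f zero + ((∑[ i ∈ allFin m ] f (suc i ↑ˡ n)) + (∑[ j ∈ allFin n ] f (suc m ↑ʳ j))) ≡⟨ +-assoc (f zero) _ _ ⟨
  f zero + (∑[ i ∈ allFin m ] f (suc i ↑ˡ n)) + (∑[ j ∈ allFin n ] f (suc m ↑ʳ j)) ≡⟨ cong (_+ (∑[ j ∈ allFin n ] f (suc m ↑ʳ j))) (∑-allFin-suc m (f ∘ (_↑ˡ n))) ⟨
  (∑[ i ∈ allFin (suc m) ] f (i ↑ˡ n)) + (∑[ j ∈ allFin n ] f (suc m ↑ʳ j)) ∎
  where open ≡-Reasoning

∑-allFin-* : ∀ m n (f : Fin (m * n) → ℕ) →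
             ∑ (allFin (m * n)) f ≡ ∑[ i ∈ allFin m ] ∑[ j ∈ allFin n ] f (combine i j)
∑-allFin-* zero    n f = refl
∑-allFin-* (suc m) n f = begin
  ∑ (allFin (n + m * n)) f ≡⟨ ∑-allFin-+ n (m * n) f ⟩
  (∑[ j ∈ allFin n ] f (j ↑ˡ (m * n))) + (∑[ k ∈ allFin (m * n) ] f (n ↑ʳ k))
    ≡⟨ cong ((∑[ j ∈ allFin n ] f (j ↑ˡ (m * n))) +_) (∑-allFin-* m n (f ∘ (n ↑ʳ_))) ⟩
  (∑[ j ∈ allFin n ] f (combine {suc m} zero j)) + (∑[ i ∈ allFin m ] ∑[ j ∈ allFin n ] f (combine (suc i) j))
    ≡⟨ ∑-allFin-suc m (λ i → ∑[ j ∈ allFin n ] f (combine i j)) ⟨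
  ∑[ i ∈ allFin (suc m) ] ∑[ j ∈ allFin n ] f (combine i j) ∎
  where open ≡-Reasoning

vertices-! : ∀ G → Unique (Graph.vertices G)
vertices-! G = Unique.map⁺ (Injection.injective (Inverse⇒Injection (↔-sym (Graph.finite G)))) (Unique.allFin⁺ _)

∈-vertices : ∀ G v → v ∈ Graph.vertices G
∈-vertices G v = subst (_∈ Graph.vertices G) (Inverse.strictlyInverseʳ (Graph.finite G) v) (∈-map⁺ _ (∈-allFin _))

length-vertices : ∀ G → length (Graph.vertices G) ≡ Graph.order G
length-vertices G = trans (List.length-map (Inverse.from (Graph.finite G)) (allFin (Graph.order G))) (List.length-tabulate {n = Graph.order G} id)

-- The enumeration of a corona runs through `V G` first and then through the pairs row by row.
∑-corona : ∀ G H (f : Graph.V (G ⊚ H) → ℕ) → ∑ (Graph.vertices (G ⊚ H)) f ≡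
           (∑[ u ∈ Graph.vertices G ] f (inj₁ u)) + (∑[ u ∈ Graph.vertices G ] ∑[ a ∈ Graph.vertices H ] f (inj₂ (u , a)))
∑-corona G H f = begin
  ∑ (Graph.vertices (G ⊚ H)) f                    ≡⟨ ∑-map _ (allFin (m + m * n)) f ⟩
  ∑[ k ∈ allFin (m + m * n) ] f (from k)          ≡⟨ ∑-allFin-+ m (m * n) (f ∘ from) ⟩
  (∑[ i ∈ allFin m ] f (from (i ↑ˡ (m * n)))) + (∑[ k ∈ allFin (m * n) ] f (from (m ↑ʳ k)))
    ≡⟨ cong ((∑[ i ∈ allFin m ] f (from (i ↑ˡ (m * n)))) +_) (∑-allFin-* m n (λ k → f (from (m ↑ʳ k)))) ⟩
  (∑[ i ∈ allFin m ] f (from (i ↑ˡ (m * n)))) + (∑[ i ∈ allFin m ] ∑[ j ∈ allFin n ] f (from (m ↑ʳ combine i j)))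
    ≡⟨ cong₂ _+_ (∑-cong (allFin m) λ {i} _ → cong f (from-↑ˡ i))
                 (∑-cong (allFin m) λ {i} _ → ∑-cong (allFin n) λ {j} _ → cong f (from-↑ʳ i j)) ⟩
  (∑[ i ∈ allFin m ] f (inj₁ (fromG i))) + (∑[ i ∈ allFin m ] ∑[ j ∈ allFin n ] f (inj₂ (fromG i , fromH j)))
    ≡⟨ cong₂ _+_ (∑-map fromG (allFin m) _)
                 (trans (∑-map fromG (allFin m) _) (∑-cong (allFin m) λ _ → ∑-map fromH (allFin n) _)) ⟨
  (∑[ u ∈ Graph.vertices G ] f (inj₁ u)) + (∑[ u ∈ Graph.vertices G ] ∑[ a ∈ Graph.vertices H ] f (inj₂ (u , a))) ∎
  where
  open ≡-Reasoning
  m = Graph.order G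
  n = Graph.order H
  from = Inverse.from (Graph.finite (G ⊚ H))
  fromG = Inverse.from (Graph.finite G)
  fromH = Inverse.from (Graph.finite H)
  fromV : Fin m ⊎ Fin (m * n) → Graph.V (G ⊚ H)
  fromV = Sum.map fromG (λ k → let (i , j) = remQuot {m} n k in fromG i , fromH j)
  from-↑ˡ : ∀ i → from (i ↑ˡ (m * n)) ≡ inj₁ (fromG i)
  from-↑ˡ i = cong fromV (Fin.splitAt-↑ˡ m i (m * n))
  from-↑ʳ : ∀ i j → from (m ↑ʳ combine i j) ≡ inj₂ (fromG i , fromH j)
  from-↑ʳ i j = trans (cong fromV (Fin.splitAt-↑ʳ m (m * n) (combine i j)))
                      (cong (λ (i , j) → inj₂ (fromG i , fromH j)) (Fin.remQuot-combine i j))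

-- Handing out prescribed labels within the colour classes.

∑-replicate : ∀ k (b : A) f → ∑ (replicate k b) f ≡ k * f b
∑-replicate zero    b f = refl
∑-replicate (suc k) b f = cong (f b +_) (∑-replicate k b f)

drop-⊆ : ∀ k {xs : List A} {x} → x ∈ drop k xs → x ∈ xs
drop-⊆ zero    x∈ = x∈
drop-⊆ (suc k) {_ ∷ _} x∈ = there (drop-⊆ k x∈)

module _ {V B : Set} (_≟_ : DecidableEquality V) where

  open Recolour _≟_

  -- The identity for all `g` says that the pairs `(c v , β v)` and the pairs of a colour and a
  -- label on its list form the same multiset; every colour count follows by choosing `g`.
  Distribution : ∀ {k} → List V → (V → Fin k) → (Fin k → List B) → Set
  Distribution {k} S c Λ = Σ[ β ∈ (V → B) ] (∀ {v} → v ∈ S → β v ∈ Λ (c v)) ×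
    (∀ (g : Fin k → B → ℕ) → ∑[ v ∈ S ] g (c v) (β v) ≡ ∑[ i ∈ allFin k ] ∑ (Λ i) (g i))

  -- Each vertex in turn takes the head of the list of its colour.
  distribute : ∀ {k S} → Unique S → B → (c : V → Fin k) (Λ : Fin k → List B) →
               (∀ i → length (Λ i) ≡ cnt c i S) → Distribution S c Λ
  -- `b₀` only serves as the value outside the list of vertices.
  distribute {k} {[]} [] b₀ c Λ |Λ| = (λ _ → b₀) , (λ ()) , λ g →
    sym (trans (∑-cong (allFin k) λ {i} _ → empty (Λ i) (|Λ| i)) (∑-0 (allFin k)))
    where
    empty : ∀ (bs : List B) {f} → length bs ≡ 0 → ∑ bs f ≡ 0
    empty [] _ = refl
  distribute {k} {x ∷ S} (x∉ ∷ S!) b₀ c Λ |Λ| = pick (Λ (c x)) refl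
    where
    Λ′ : Fin k → List B
    -- Removes one label from the list of the colour of `x` and none from the others.
    Λ′ i = drop (δ (c x) i) (Λ i)

    |Λ′| : ∀ i → length (Λ′ i) ≡ cnt c i S
    |Λ′| i = trans (List.length-drop (δ (c x) i) (Λ i)) (trans (cong (_∸ δ (c x) i) (|Λ| i)) (m+n∸m≡n (δ (c x) i) _))

    pick : ∀ bs → Λ (c x) ≡ bs → Distribution (x ∷ S) c Λ
    pick [] e = contradiction
      (subst₂ _≤_ (δ-refl (c x)) (trans (sym (|Λ| (c x))) (cong length e)) (m≤m+n (δ (c x) (c x)) _)) λ ()
    pick (b ∷ bs) e with distribute S! b₀ c Λ′ |Λ′|
    ... | β′ , β′∈ , sums = β′ [ x ≔ b ] , mem , total
      where
      mem : ∀ {v} → v ∈ x ∷ S → (β′ [ x ≔ b ]) v ∈ Λ (c v)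
      mem (here refl) = subst₂ _∈_ (sym (≔-same β′ x b)) (sym e) (here refl)
      mem {v} (there v∈) = subst (_∈ Λ (c v)) (sym (≔-other β′ b λ { refl → All.lookup x∉ v∈ refl })) (drop-⊆ (δ (c x) (c v)) (β′∈ v∈))

      split : ∀ (g : Fin k → B → ℕ) i → ∑ (Λ i) (g i) ≡ δ (c x) i * g i b + ∑ (Λ′ i) (g i)
      split g i with c x Fin.≟ i
      ... | no _     = refl
      ... | yes refl rewrite e = cong (_+ ∑ bs (g i)) (sym (+-identityʳ (g i b)))

      total : ∀ (g : Fin k → B → ℕ) → ∑[ v ∈ x ∷ S ] g (c v) ((β′ [ x ≔ b ]) v) ≡ ∑[ i ∈ allFin k ] ∑ (Λ i) (g i)
      total g = sym (begin
        ∑[ i ∈ allFin k ] ∑ (Λ i) (g i) ≡⟨ ∑-cong (allFin k) (λ {i} _ → split g i) ⟩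
        ∑[ i ∈ allFin k ] (δ (c x) i * g i b + ∑ (Λ′ i) (g i)) ≡⟨ ∑-+ (allFin k) _ _ ⟩
        (∑[ i ∈ allFin k ] δ (c x) i * g i b) + (∑[ i ∈ allFin k ] ∑ (Λ′ i) (g i))
          ≡⟨ cong₂ _+_ (∑-sift Fin._≟_ (Unique.allFin⁺ k) (∈-allFin (c x)) (λ i → g i b)) (sym (sums g)) ⟩
        g (c x) b + (∑[ v ∈ S ] g (c v) (β′ v))
          ≡⟨ cong₂ _+_ (cong (g (c x)) (sym (≔-same β′ x b)))
                       (∑-cong S λ {v} v∈ → cong (g (c v)) (sym (≔-other β′ b λ { refl → All.lookup x∉ v∈ refl }))) ⟩
        ∑[ v ∈ x ∷ S ] g (c v) ((β′ [ x ≔ b ]) v) ∎)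
        where open ≡-Reasoning

-- Class 0 is split into colours 0 and 1; colour 0 is the part diverted to the colour missing from a block.
splitColour : Fin 3 → Bool → Fin 4
splitColour zero    true  = # 0
splitColour zero    false = # 1
splitColour (suc i) _     = suc (suc i)

merge : Fin 4 → Fin 3
merge zero    = zero
merge (suc i) = i

merge-splitColour : ∀ i b → merge (splitColour i b) ≡ i
merge-splitColour zero    true  = refl
merge-splitColour zero    false = refl
merge-splitColour (suc i) b     = refl

-- 3-colourings of `H` with one large class cut in two.

module _ (H : Graph) where

  private
    vs = Graph.vertices H
    n  = Graph.order H

  -- Colours 0 and 1 are the diverted and the remaining part of the large class; 2 and 3 are the
  -- other classes.
  SplitInto : ℕ → ℕ → ℕ → ℕ → Set
  SplitInto x y b d = Σ[ φ ∈ (Graph.V H → Fin 4) ] IsProper H φ ×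
    cnt φ (# 0) vs ≡ x × cnt φ (# 1) vs ≡ y × cnt φ (# 2) vs ≡ b × cnt φ (# 3) vs ≡ d

  ∑-cnt : ∀ {k} (c : Graph.V H → Fin k) → ∑[ i ∈ allFin k ] cnt c i vs ≡ n
  ∑-cnt {k} c = begin
    ∑[ i ∈ allFin k ] cnt c i vs           ≡⟨ ∑-cong (allFin k) (λ _ → sym (*-identityʳ _)) ⟩
    ∑[ i ∈ allFin k ] cnt c i vs * 1       ≡⟨ by-class c (λ _ → 1) vs ⟨
    ∑[ v ∈ vs ] 1                          ≡⟨ trans (∑-const vs 1) (*-identityʳ _) ⟩
    length vs                              ≡⟨ length-vertices H ⟩
    n                                      ∎
    where open ≡-Reasoning

  module _ (h : Graph.V H → Fin 3) (proper : IsProper H h) where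

    -- Merging colours 0 and 1 gives back `h`, so the finer colouring is proper too.
    split-class₀ : ∀ {x} → x ≤ cnt h (# 0) vs → SplitInto x (cnt h (# 0) vs ∸ x) (cnt h (# 1) vs) (cnt h (# 2) vs)
    split-class₀ {x} x≤a = φ , φ-proper , trans (sums (# 0)) (count₀ x (a ∸ x) b d) , trans (sums (# 1)) (count₁ x (a ∸ x) b d) ,
      trans (sums (# 2)) (count₂ x (a ∸ x) b d) , trans (sums (# 3)) (count₃ x (a ∸ x) b d)
      where
      a = cnt h (# 0) vs
      b = cnt h (# 1) vs
      d = cnt h (# 2) vs
      Λ : Fin 3 → List Bool
      Λ zero    = replicate x true ++ replicate (a ∸ x) false
      Λ (suc i) = replicate (cnt h (suc i) vs) false
      |Λ| : ∀ i → length (Λ i) ≡ cnt h i vs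
      |Λ| zero    = trans (List.length-++ (replicate x true))
        (trans (cong₂ _+_ (List.length-replicate x) (List.length-replicate (a ∸ x))) (m+[n∸m]≡n x≤a))
      |Λ| (suc i) = List.length-replicate _
      D = distribute (Graph._≟ⱽ_ H) (vertices-! H) true h Λ |Λ|
      β = proj₁ D
      φ : Graph.V H → Fin 4
      φ v = splitColour (h v) (β v)
      φ-proper : IsProper H φ
      φ-proper u~v e = proper u~v (trans (sym (merge-splitColour _ _)) (trans (cong merge e) (merge-splitColour _ _)))
      sums : ∀ j → cnt φ j vs ≡ (x * δ (# 0) j + (a ∸ x) * δ (# 1) j) + (b * δ (# 2) j + (d * δ (# 3) j + 0))
      sums j = trans (proj₂ (proj₂ D) (λ i b → δ (splitColour i b) j))
        (cong₂ _+_ (trans (∑-++ (replicate x true) _ _) (cong₂ _+_ (∑-replicate x _ _) (∑-replicate (a ∸ x) _ _)))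
          (cong₂ _+_ (∑-replicate b _ _) (cong (_+ 0) (∑-replicate d _ _))))
      count₀ : ∀ x y b d → (x * 1 + y * 0) + (b * 0 + (d * 0 + 0)) ≡ x
      count₀ = solve-∀
      count₁ : ∀ x y b d → (x * 0 + y * 1) + (b * 0 + (d * 0 + 0)) ≡ y
      count₁ = solve-∀
      count₂ : ∀ x y b d → (x * 0 + y * 0) + (b * 1 + (d * 0 + 0)) ≡ b
      count₂ = solve-∀
      count₃ : ∀ x y b d → (x * 0 + y * 0) + (b * 0 + (d * 1 + 0)) ≡ d
      count₃ = solve-∀

  -- `large` is what keeps the diverted part in a 4-block within the `a` vertices available.
  record Splitting : Set where
    field
      a b d : ℕ
      a+b+d : a + (b + (d + 0)) ≡ n
      large : suc n ≤ a * 5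
      split : ∀ {x} → x ≤ a → SplitInto x (a ∸ x) b d

  -- If no class had more than `n / 5` vertices, the three could not cover `H`. A class above this
  -- bound is renamed to colour 0.
  splitting : 1 ≤ n → Colorable H 3 → Splitting
  splitting 1≤n (h , proper) = record { a+b+d = ∑-cnt h′ ; large = big ; split = split-class₀ h′ proper′ }
    where
    large-class : ∃[ i ] suc n ≤ cnt h i vs * 5
    large-class with Fin.any? (λ i → suc n ≤? cnt h i vs * 5)
    ... | yes r = r
    ... | no ¬r = contradiction (begin
      1 + n * 4                             ≡⟨ +-comm 1 (n * 4) ⟩
      n * 4 + 1                             ≤⟨ +-monoʳ-≤ (n * 4) 1≤n ⟩
      n * 4 + n                             ≡⟨ lemma n ⟩
      n * 5                                 ≡⟨ trans (*-comm n 5) (cong (5 *_) (sym (∑-cnt h))) ⟩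
      5 * (∑[ i ∈ allFin 3 ] cnt h i vs)    ≡⟨ trans (∑-cong (allFin 3) (λ {i} _ → *-comm (cnt h i vs) 5)) (∑-* 5 (allFin 3) (λ i → cnt h i vs)) ⟨
      ∑[ i ∈ allFin 3 ] cnt h i vs * 5      ≤⟨ ∑-mono (allFin 3) (λ {i} _ → s≤s⁻¹ (≰⇒> λ r → ¬r (i , r))) ⟩
      ∑[ i ∈ allFin 3 ] n                   ≡⟨ trans (∑-const (allFin 3) n) (*-comm 3 n) ⟩
      n * 3                                 ≤⟨ *-monoʳ-≤ n (from-yes (3 ≤? 4)) ⟩
      n * 4                                 ∎) 1+n≰n
      where
      open ≤-Reasoning
      lemma : ∀ n → n * 4 + n ≡ n * 5
      lemma = solve-∀
    i = proj₁ large-class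
    τ = transpose zero i
    h′ = τ ∘ h
    proper′ : IsProper H h′
    proper′ u~v e = proper u~v (trans (sym (transpose-inverse i zero)) (trans (cong (transpose i zero) e) (transpose-inverse i zero)))
    transpose-zero : ∀ i → transpose {3} i zero zero ≡ i
    transpose-zero = from-yes (Fin.all? λ i → transpose {3} i zero zero Fin.≟ i)
    big : suc n ≤ cnt h′ zero vs * 5
    big = subst (λ m → suc n ≤ m * 5)
      (sym (trans (cnt-relabel τ (transpose i zero) (λ _ → transpose-inverse i zero) (λ _ → transpose-inverse zero i) h zero vs)
                  (cong (λ j → cnt h j vs) (transpose-zero i)))) (proj₂ large-class)

-- Sums over cyclically shifted colours, and over all colours but one.

rotate : ∀ {n} → Fin (suc n) → Fin (suc n)
rotate {n} i = suc (toℕ i) mod suc n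

∑-rotate₄ : ∀ g → ∑ (allFin 4) (g ∘ rotate) ≡ ∑ (allFin 4) g
∑-rotate₄ g = cycle (g (# 0)) (g (# 1)) (g (# 2)) (g (# 3))
  where
  cycle : ∀ a b d e → b + (d + (e + (a + 0))) ≡ a + (b + (d + (e + 0)))
  cycle = solve-∀

∑-rotate₅ : ∀ g → ∑ (allFin 5) (g ∘ rotate) ≡ ∑ (allFin 5) g
∑-rotate₅ g = cycle (g (# 0)) (g (# 1)) (g (# 2)) (g (# 3)) (g (# 4))
  where
  cycle : ∀ a b d e f → b + (d + (e + (f + (a + 0)))) ≡ a + (b + (d + (e + (f + 0))))
  cycle = solve-∀

-- The summands are the contributions at one vertex of a block: the vertex, the two parts of the
-- large class, the two other classes. Summed over the whole cycle, the shifts disappear.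
∑-rotations : ∀ {n} → (∀ g → ∑ (allFin (suc n)) (g ∘ rotate) ≡ ∑ (allFin (suc n)) g) → ∀ g₀ g₁ g₂ g₃ g₄ →
  ∑[ q ∈ allFin (suc n) ] (g₀ q + (g₁ (rotate q) + (g₂ (rotate q) + (g₃ (rotate (rotate q)) + (g₄ (rotate (rotate (rotate q))) + 0))))) ≡
  ∑[ q ∈ allFin (suc n) ] (g₀ q + (g₁ q + (g₂ q + (g₃ q + (g₄ q + 0)))))
∑-rotations {n} ρ g₀ g₁ g₂ g₃ g₄ =
  add {f = g₀} {f′ = g₀} refl (add (ρ g₁) (add (ρ g₂) (add (trans (ρ (g₃ ∘ rotate)) (ρ g₃))
    (add (trans (ρ (g₄ ∘ rotate ∘ rotate)) (trans (ρ (g₄ ∘ rotate)) (ρ g₄))) (refl {x = ∑[ q ∈ allFin (suc n) ] 0})))))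
  where
  add : ∀ {f g f′ g′ : Fin (suc n) → ℕ} → ∑ (allFin (suc n)) f ≡ ∑ (allFin (suc n)) f′ → ∑ (allFin (suc n)) g ≡ ∑ (allFin (suc n)) g′ →
        ∑[ x ∈ allFin (suc n) ] (f x + g x) ≡ ∑[ x ∈ allFin (suc n) ] (f′ x + g′ x)
  add {f} {g} {f′} {g′} e e′ = trans (∑-+ (allFin (suc n)) f g) (trans (cong₂ _+_ e e′) (sym (∑-+ (allFin (suc n)) f′ g′)))

∑-punchIn : ∀ {n} k g → ∑ (allFin (suc n)) g ≡ g k + ∑ (allFin n) (g ∘ punchIn k)
∑-punchIn {n}     zero    g = ∑-allFin-suc n g
∑-punchIn {suc n} (suc k) g = begin
  ∑ (allFin (suc (suc n))) g                                       ≡⟨ ∑-allFin-suc (suc n) g ⟩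
  g zero + ∑ (allFin (suc n)) (g ∘ suc)                            ≡⟨ cong (g zero +_) (∑-punchIn k (g ∘ suc)) ⟩
  g zero + (g (suc k) + ∑ (allFin n) (g ∘ suc ∘ punchIn k))        ≡⟨ exchange₁₂ (g zero) (g (suc k)) _ ⟩
  g (suc k) + (g zero + ∑ (allFin n) (g ∘ suc ∘ punchIn k))        ≡⟨ cong (g (suc k) +_) (∑-allFin-suc n (g ∘ punchIn (suc k))) ⟨
  g (suc k) + ∑ (allFin (suc n)) (g ∘ punchIn (suc k))             ∎
  where
  open ≡-Reasoning
  exchange₁₂ : ∀ a b d → a + (b + d) ≡ b + (a + d)
  exchange₁₂ = solve-∀

punchIn-cases : ∀ {n} (k : Fin (suc n)) (P : Fin (suc n) → Set) → P k → (∀ q → P (punchIn k q)) → ∀ i → P i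
punchIn-cases k P pk pq i with k Fin.≟ i
... | yes refl = pk
... | no k≢i   = subst P (Fin.punchIn-punchOut k≢i) (pq (punchOut k≢i))

-- Blocks of vertices and colourings of their copies of `H`.

module Blocks (H : Graph) (spl : Splitting H) where

  open Splitting spl

  private
    vs = Graph.vertices H
    s : ℕ
    s = suc (Graph.order H)

  Filling : Set
  Filling = Graph.V H → Fin 5

  -- The contribution to colour `j` of a vertex of colour `i` together with its copy of `H`.
  weight : Fin 5 → Filling → Fin 5 → ℕ
  weight i ψ j = δ i j + cnt ψ j vs

  Good : Fin 5 → Filling → Set
  Good i ψ = IsProper H ψ × (∀ w → ψ w ≢ i)

  total : (Fin 5 → List Filling) → Fin 5 → ℕ
  total Λ j = ∑[ i ∈ allFin 5 ] ∑[ ψ ∈ Λ i ] weight i ψ j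

  -- A block stands for N vertices, f i of them of colour i; Λ i lists the colourings of the copies of H attached
  -- to the latter.  They take the colour totals from balanced for T vertices to balanced for N * s more.
  FillingFrom : ℕ → ℕ → (Fin 5 → ℕ) → Set
  FillingFrom T N f = Σ[ Λ ∈ (Fin 5 → List Filling) ]
    (∀ i → length (Λ i) ≡ f i) × (∀ i {ψ} → ψ ∈ Λ i → Good i ψ) ×
    (∀ j → share T j + total Λ j ≡ share (N * s + T) j)

  -- Fillings from every `T` are required so that blocks can follow one another.
  record Block (N : ℕ) (f : Fin 5 → ℕ) : Set where
    constructor block
    field fill : ∀ T → FillingFrom T N f

  open Block public

  relabel : ∀ {N f g} → (∀ i → f i ≡ g i) → Block N f → Block N g
  fill (relabel f≗g blk) T with fill blk T
  ... | Λ , |Λ| , rest = Λ , (λ i → trans (|Λ| i) (f≗g i)) , rest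

  _⊕_ : ∀ {M N f g} → Block M f → Block N g → Block (M + N) (λ i → f i + g i)
  fill (_⊕_ {M} {N} blk blk′) T with fill blk T
  -- The second block starts from the total that the first has reached.
  ... | Λ , |Λ| , good , tot with fill blk′ (M * s + T)
  ... | Λ′ , |Λ′| , good′ , tot′ =
    Λ″ ,
    (λ i → trans (List.length-++ (Λ i)) (cong₂ _+_ (|Λ| i) (|Λ′| i))) ,
    (λ i ψ∈ → Sum.[ good i , good′ i ] (∈-++⁻ (Λ i) ψ∈)) ,
    λ j → begin
      share T j + total Λ″ j                 ≡⟨ cong (share T j +_) (total-++ j) ⟩
      share T j + (total Λ j + total Λ′ j)   ≡⟨ +-assoc (share T j) _ _ ⟨
      share T j + total Λ j + total Λ′ j     ≡⟨ cong (_+ total Λ′ j) (tot j) ⟩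
      share (M * s + T) j + total Λ′ j       ≡⟨ tot′ j ⟩
      share (N * s + (M * s + T)) j          ≡⟨ cong (λ t → share t j) (regroup M N s T) ⟩
      share ((M + N) * s + T) j              ∎
    where
    open ≡-Reasoning
    Λ″ : Fin 5 → List Filling
    Λ″ i = Λ i ++ Λ′ i
    total-++ : ∀ j → total Λ″ j ≡ total Λ j + total Λ′ j
    total-++ j = trans (∑-cong (allFin 5) λ {i} _ → ∑-++ (Λ i) (Λ′ i) (λ ψ → weight i ψ j))
      (∑-+ (allFin 5) (λ i → ∑[ ψ ∈ Λ i ] weight i ψ j) (λ i → ∑[ ψ ∈ Λ′ i ] weight i ψ j))
    regroup : ∀ M N s T → N * s + (M * s + T) ≡ (M + N) * s + T
    regroup = solve-∀

  module _ (ι : Fin 4 → Fin 5) (ι-injective : ∀ {q r} → ι q ≡ ι r → q ≡ r) {x} (x≤a : x ≤ a) where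

    paint : Filling
    paint v = ι (proj₁ (split x≤a) v)

    paint-good : ∀ {i} → (∀ q → ι q ≢ i) → Good i paint
    paint-good ι≢i = (λ u~v e → proj₁ (proj₂ (split x≤a)) u~v (ι-injective e)) , λ w → ι≢i _

    cnt-paint : ∀ j → cnt paint j vs ≡ x * δ (ι (# 0)) j + ((a ∸ x) * δ (ι (# 1)) j + (b * δ (ι (# 2)) j + (d * δ (ι (# 3)) j + 0)))
    cnt-paint j with split x≤a
    ... | φ , _ , e₀ , e₁ , e₂ , e₃ =
      trans (by-class φ (λ q → δ (ι q) j) vs)
        (cong₂ _+_ (cong (_* _) e₀) (cong₂ _+_ (cong (_* _) e₁) (cong₂ _+_ (cong (_* _) e₂) (cong (λ t → t * δ (ι (# 3)) j + 0) e₃))))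

  -- Nothing is diverted in a 5-block; the empty part receives the left-over colour `i + 4` to keep
  -- the map injective.
  spokes : Fin 5 → Fin 4 → Fin 5
  spokes i zero                   = rotate (rotate (rotate (rotate i)))
  spokes i (suc zero)             = rotate i
  spokes i (suc (suc zero))       = rotate (rotate i)
  spokes i (suc (suc (suc zero))) = rotate (rotate (rotate i))

  spokes-injective : ∀ i {q r} → spokes i q ≡ spokes i r → q ≡ r
  spokes-injective i {q} {r} = from-yes (Fin.all? λ i → Fin.all? λ q → Fin.all? λ r →
    (spokes i q Fin.≟ spokes i r) →-dec (q Fin.≟ r)) i q r

  spokes-≢ : ∀ i q → spokes i q ≢ i
  spokes-≢ = from-yes (Fin.all? λ i → Fin.all? λ q → ¬? (spokes i q Fin.≟ i))

  -- The diverted part receives the missing colour `k`; the rest proceeds cyclically through the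
  -- four present colours, numbered by `punchIn k`.
  spokes-without : Fin 5 → Fin 4 → Fin 4 → Fin 5
  spokes-without k q zero                   = k
  spokes-without k q (suc zero)             = punchIn k (rotate q)
  spokes-without k q (suc (suc zero))       = punchIn k (rotate (rotate q))
  spokes-without k q (suc (suc (suc zero))) = punchIn k (rotate (rotate (rotate q)))

  spokes-without-injective : ∀ k p {q r} → spokes-without k p q ≡ spokes-without k p r → q ≡ r
  spokes-without-injective k p {q} {r} = from-yes (Fin.all? λ k → Fin.all? λ p → Fin.all? λ q → Fin.all? λ r →
    (spokes-without k p q Fin.≟ spokes-without k p r) →-dec (q Fin.≟ r)) k p q r

  spokes-without-≢ : ∀ k p q → spokes-without k p q ≢ punchIn k p
  spokes-without-≢ = from-yes (Fin.all? λ k → Fin.all? λ p → Fin.all? λ q → ¬? (spokes-without k p q Fin.≟ punchIn k p))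

  -- Each colour occurs once on the five vertices and once for each class of `H`, which gives it
  -- `1 + a + b + d = s`.
  rainbow : Block 5 (λ _ → 1)
  fill rainbow T = Λ , (λ _ → refl) , (λ { i (here refl) → paint-good (spokes i) (spokes-injective i) z≤n (spokes-≢ i) }) , λ j → begin
    share T j + total Λ j   ≡⟨ cong (share T j +_) (total-Λ j) ⟩
    share T j + s           ≡⟨ +-comm (share T j) s ⟩
    s + share T j           ≡⟨ share-5* s T j ⟨
    share (s * 5 + T) j     ≡⟨ cong (λ m → share (m + T) j) (*-comm s 5) ⟩
    share (5 * s + T) j     ∎
    where
    open ≡-Reasoning
    ψ : Fin 5 → Filling
    ψ i = paint (spokes i) (spokes-injective i) z≤n
    Λ : Fin 5 → List Filling
    Λ i = ψ i ∷ []
    total-Λ : ∀ j → total Λ j ≡ s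
    total-Λ j = begin
      total Λ j
        ≡⟨ ∑-cong (allFin 5) (λ {i} _ → trans (+-identityʳ _) (cong (δ i j +_) (cnt-paint (spokes i) (spokes-injective i) z≤n j))) ⟩
      ∑[ i ∈ allFin 5 ] (δ i j + (0 + (a * δ (rotate i) j + (b * δ (rotate (rotate i)) j + (d * δ (rotate (rotate (rotate i))) j + 0)))))
        ≡⟨ ∑-rotations ∑-rotate₅ (λ i → δ i j) (λ _ → 0) (λ i → a * δ i j) (λ i → b * δ i j) (λ i → d * δ i j) ⟩
      ∑[ i ∈ allFin 5 ] (δ i j + (0 + (a * δ i j + (b * δ i j + (d * δ i j + 0)))))
        ≡⟨ ∑-cong (allFin 5) (λ {i} _ → factor a b d (δ i j)) ⟩
      ∑[ i ∈ allFin 5 ] suc (a + (b + (d + 0))) * δ i j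
        ≡⟨ ∑-* (suc (a + (b + (d + 0)))) (allFin 5) (λ i → δ i j) ⟩
      suc (a + (b + (d + 0))) * (∑[ i ∈ allFin 5 ] δ i j)
        ≡⟨ cong₂ _*_ (cong suc a+b+d) (trans (∑-cong (allFin 5) (λ {i} _ → ⟦⟧-cong sym sym (i Fin.≟ j) (j Fin.≟ i))) (∑-δ j)) ⟩
      s * 1
        ≡⟨ *-identityʳ s ⟩
      s ∎
      where
      factor : ∀ a b d t → t + (0 + (a * t + (b * t + (d * t + 0)))) ≡ suc (a + (b + (d + 0))) * t
      factor = solve-∀

  module _ (k : Fin 5) (T : ℕ) where

    private
      T₄ T₅ : ℕ
      T₄ = 4 * s + T
      T₅ = s * 5 + T

      ι = punchIn k

      -- `T₅` is the total after a full 5-block. A present colour receiving all of `s` would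
      -- overshoot its share for `T₄` by this amount, which is therefore diverted to `k`.
      spare : Fin 4 → ℕ
      spare q = share T₅ (ι q) ∸ share T₄ (ι q)

      T₄≤T₅ : T₄ ≤ T₅
      T₄≤T₅ = +-monoˡ-≤ T (≤-trans (*-monoˡ-≤ s (n≤1+n 4)) (≤-reflexive (*-comm 5 s)))

      spare-eq : ∀ q → spare q + share T₄ (ι q) ≡ s + share T (ι q)
      spare-eq q = trans (m∸n+n≡m (share-mono (ι q) T₄≤T₅)) (share-5* s T (ι q))

      -- `T₅` is `s + T₄` with `s ≤ 5 a`, so a share grows by at most `a` between the two.
      spare≤a : ∀ q → spare q ≤ a
      spare≤a q = m≤n+o⇒m∸n≤o (share T₅ (ι q)) (share T₄ (ι q)) (begin
        share T₅ (ι q)            ≤⟨ share-mono (ι q) (≤-trans (≤-reflexive (regroup s T)) (+-monoˡ-≤ T₄ large)) ⟩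
        share (a * 5 + T₄) (ι q)  ≡⟨ share-5* a T₄ (ι q) ⟩
        a + share T₄ (ι q)        ≡⟨ +-comm a _ ⟩
        share T₄ (ι q) + a        ∎)
        where
        open ≤-Reasoning
        regroup : ∀ s T → s * 5 + T ≡ s + (4 * s + T)
        regroup = solve-∀

      ψ : Fin 4 → Filling
      -- At position `q` the large class has the next colour, so the spare amount of that colour is
      -- diverted.
      ψ q = paint (spokes-without k q) (spokes-without-injective k q) (spare≤a (rotate q))

      Λ : Fin 5 → List Filling
      Λ = Vec.insertAt (λ q → ψ q ∷ []) k []

      kept : Fin 4 → ℕ
      kept q = suc (a ∸ spare q + (b + (d + 0)))

      kept-eq : ∀ q → kept q + spare q ≡ s
      kept-eq q = trans (move (a ∸ spare q) (b + (d + 0)) (spare q))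
        (cong suc (trans (cong (_+ (b + (d + 0))) (m∸n+n≡m (spare≤a q))) a+b+d))
        where
        move : ∀ y t x → suc (y + t) + x ≡ suc (y + x + t)
        move = solve-∀

      total-Λ : ∀ j → total Λ j ≡ ∑[ q ∈ allFin 4 ] (kept q * δ (ι q) j + spare q * δ k j)
      total-Λ j = begin
        total Λ j
          ≡⟨ ∑-punchIn k (λ i → ∑[ ψ ∈ Λ i ] weight i ψ j) ⟩
        (∑[ ψ ∈ Λ k ] weight k ψ j) + (∑[ q ∈ allFin 4 ] ∑[ ψ ∈ Λ (ι q) ] weight (ι q) ψ j)
          ≡⟨ cong₂ _+_ (cong (λ ψs → ∑[ ψ ∈ ψs ] weight k ψ j) (Vec.insertAt-lookup (λ q → ψ q ∷ []) k []))
               (∑-cong (allFin 4) λ {q} _ → cong (λ ψs → ∑[ ψ ∈ ψs ] weight (ι q) ψ j) (Vec.insertAt-punchIn (λ q → ψ q ∷ []) k [] q)) ⟩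
        ∑[ q ∈ allFin 4 ] (weight (ι q) (ψ q) j + 0)
          ≡⟨ ∑-cong (allFin 4) (λ {q} _ → trans (+-identityʳ _)
               (cong (δ (ι q) j +_) (cnt-paint (spokes-without k q) (spokes-without-injective k q) (spare≤a (rotate q)) j))) ⟩
        ∑[ q ∈ allFin 4 ] (δ (ι q) j + (spare (rotate q) * δ k j + ((a ∸ spare (rotate q)) * δ (ι (rotate q)) j +
          (b * δ (ι (rotate (rotate q))) j + (d * δ (ι (rotate (rotate (rotate q)))) j + 0)))))
          ≡⟨ ∑-rotations ∑-rotate₄ (λ q → δ (ι q) j) (λ q → spare q * δ k j) (λ q → (a ∸ spare q) * δ (ι q) j)
               (λ q → b * δ (ι q) j) (λ q → d * δ (ι q) j) ⟩
        ∑[ q ∈ allFin 4 ] (δ (ι q) j + (spare q * δ k j + ((a ∸ spare q) * δ (ι q) j + (b * δ (ι q) j + (d * δ (ι q) j + 0)))))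
          ≡⟨ ∑-cong (allFin 4) (λ {q} _ → factor (δ (ι q) j) (spare q * δ k j) (a ∸ spare q) b d) ⟩
        ∑[ q ∈ allFin 4 ] (kept q * δ (ι q) j + spare q * δ k j) ∎
        where
        open ≡-Reasoning
        factor : ∀ t u y b d → t + (u + (y * t + (b * t + (d * t + 0)))) ≡ suc (y + (b + (d + 0))) * t + u
        factor = solve-∀

      total-present : ∀ q → total Λ (ι q) ≡ kept q
      total-present q = begin
        total Λ (ι q)
          ≡⟨ total-Λ (ι q) ⟩
        ∑[ r ∈ allFin 4 ] (kept r * δ (ι r) (ι q) + spare r * δ k (ι q))
          ≡⟨ ∑-cong (allFin 4) (λ {r} _ → trans (cong₂ _+_ (trans (*-comm (kept r) (δ (ι r) (ι q)))
               (cong (_* kept r) (⟦⟧-cong (sym ∘ Fin.punchIn-injective k r q) (cong ι ∘ sym) (ι r Fin.≟ ι q) (q Fin.≟ r))))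
               (trans (cong (spare r *_) (δ-≢ (Fin.punchInᵢ≢i k q ∘ sym))) (*-zeroʳ (spare r)))) (+-identityʳ _)) ⟩
        ∑[ r ∈ allFin 4 ] δ q r * kept r
          ≡⟨ ∑-sift Fin._≟_ (Unique.allFin⁺ 4) (∈-allFin q) kept ⟩
        kept q ∎
        where open ≡-Reasoning

      total-missing : total Λ k ≡ ∑ (allFin 4) spare
      total-missing = trans (total-Λ k) (∑-cong (allFin 4) λ {q} _ →
        cong₂ _+_ (trans (cong (kept q *_) (δ-≢ (Fin.punchInᵢ≢i k q))) (*-zeroʳ (kept q)))
                  (trans (cong (spare q *_) (δ-refl k)) (*-identityʳ (spare q))))

      total-share : ∀ j → share T j + total Λ j ≡ share T₄ j
      total-share = punchIn-cases k _ missing present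
        where
        open ≡-Reasoning
        present : ∀ q → share T (ι q) + total Λ (ι q) ≡ share T₄ (ι q)
        present q = +-cancelʳ-≡ (spare q) _ _ (begin
          share T (ι q) + total Λ (ι q) + spare q   ≡⟨ cong (λ t → share T (ι q) + t + spare q) (total-present q) ⟩
          share T (ι q) + kept q + spare q          ≡⟨ +-assoc (share T (ι q)) _ _ ⟩
          share T (ι q) + (kept q + spare q)        ≡⟨ cong (share T (ι q) +_) (kept-eq q) ⟩
          share T (ι q) + s                         ≡⟨ +-comm _ s ⟩
          s + share T (ι q)                         ≡⟨ spare-eq q ⟨
          spare q + share T₄ (ι q)                  ≡⟨ +-comm (spare q) _ ⟩
          share T₄ (ι q) + spare q                  ∎)
        missing : share T k + total Λ k ≡ share T₄ k
        -- The missing colour is settled by the grand total: with the shares of the four present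
        -- colours added, both sides equal `T₄`.
        missing = +-cancelʳ-≡ (∑ (allFin 4) (share T₄ ∘ ι)) _ _ (begin
          share T k + total Λ k + ∑ (allFin 4) (share T₄ ∘ ι)
            ≡⟨ trans (+-assoc (share T k) _ _) (cong (λ t → share T k + (t + ∑ (allFin 4) (share T₄ ∘ ι))) total-missing) ⟩
          share T k + (∑ (allFin 4) spare + ∑ (allFin 4) (share T₄ ∘ ι))
            ≡⟨ cong (share T k +_) (∑-+ (allFin 4) spare (share T₄ ∘ ι)) ⟨
          share T k + (∑[ q ∈ allFin 4 ] (spare q + share T₄ (ι q)))
            ≡⟨ cong (share T k +_) (∑-cong (allFin 4) (λ {q} _ → spare-eq q)) ⟩
          share T k + (∑[ q ∈ allFin 4 ] (s + share T (ι q)))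
            ≡⟨ cong (share T k +_) (∑-+ (allFin 4) (λ _ → s) (share T ∘ ι)) ⟩
          share T k + (4 * s + ∑ (allFin 4) (share T ∘ ι))
            ≡⟨ swap₁₂ (share T k) (4 * s) _ ⟩
          4 * s + (share T k + ∑ (allFin 4) (share T ∘ ι))
            ≡⟨ cong (4 * s +_) (trans (sym (∑-punchIn k (share T))) (∑-share T)) ⟩
          T₄
            ≡⟨ ∑-share T₄ ⟨
          ∑ (allFin 5) (share T₄)
            ≡⟨ ∑-punchIn k (share T₄) ⟩
          share T₄ k + ∑ (allFin 4) (share T₄ ∘ ι) ∎)
          where
          swap₁₂ : ∀ a b c → a + (b + c) ≡ b + (a + c)
          swap₁₂ = solve-∀

    fill-without : FillingFrom T 4 (λ i → 1 ∸ δ k i)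
    fill-without = Λ , punchIn-cases k _
        (trans (cong length Λk) (cong (1 ∸_) (sym (δ-refl k))))
        (λ q → trans (cong length (Λι q)) (cong (1 ∸_) (sym (δ-≢ (Fin.punchInᵢ≢i k q ∘ sym))))) ,
      (λ i → punchIn-cases k (λ i → ∀ {ψ} → ψ ∈ Λ i → Good i ψ)
        (λ ψ∈ → contradiction (subst (_ ∈_) Λk ψ∈) λ ())
        (λ q ψ∈ → good q (subst (_ ∈_) (Λι q) ψ∈)) i) ,
      total-share
      where
      Λk = Vec.insertAt-lookup (λ q → ψ q ∷ []) k []
      Λι = Vec.insertAt-punchIn (λ q → ψ q ∷ []) k []
      good : ∀ q {χ} → χ ∈ ψ q ∷ [] → Good (ι q) χ
      good q (here refl) = paint-good (spokes-without k q) (spokes-without-injective k q) (spare≤a (rotate q)) (spokes-without-≢ k q)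

  without : ∀ k → Block 4 (λ i → 1 ∸ δ k i)
  without k = block (fill-without k)

  -- In the base cases the omitted colours are those not yet dealt in the last round; each further
  -- step adds a 5-block.
  blocks-from-12 : ∀ N → Block (12 + N) (share (12 + N))
  blocks-from-12 0 = relabel
    (from-yes (Fin.all? λ i → ((1 ∸ δ (# 2) i) + (1 ∸ δ (# 3) i)) + (1 ∸ δ (# 4) i) ℕ.≟ share 12 i))
    ((without (# 2) ⊕ without (# 3)) ⊕ without (# 4))
  blocks-from-12 1 = relabel
    (from-yes (Fin.all? λ i → 1 + ((1 ∸ δ (# 3) i) + (1 ∸ δ (# 4) i)) ℕ.≟ share 13 i))
    (rainbow ⊕ (without (# 3) ⊕ without (# 4)))
  blocks-from-12 2 = relabel
    (from-yes (Fin.all? λ i → 1 + (1 + (1 ∸ δ (# 4) i)) ℕ.≟ share 14 i))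
    (rainbow ⊕ (rainbow ⊕ without (# 4)))
  blocks-from-12 3 = relabel
    (from-yes (Fin.all? λ i → 3 ℕ.≟ share 15 i))
    (rainbow ⊕ (rainbow ⊕ rainbow))
  blocks-from-12 4 = relabel
    (from-yes (Fin.all? λ i → ((1 ∸ δ (# 1) i) + (1 ∸ δ (# 2) i)) + ((1 ∸ δ (# 3) i) + (1 ∸ δ (# 4) i)) ℕ.≟ share 16 i))
    ((without (# 1) ⊕ without (# 2)) ⊕ (without (# 3) ⊕ without (# 4)))
  blocks-from-12 (suc (suc (suc (suc (suc N))))) =
    relabel (λ i → sym (share-5+ (12 + N) i)) (rainbow ⊕ blocks-from-12 N)

  -- 11 is the only number above 7 that is not of the form 4 x + 5 y.
  blocks : ∀ {N} → 8 ≤ N → N ≢ 11 → Block N (share N)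
  blocks {N} 8≤N N≢11 with m≤n⇒∃[o]m+o≡n 8≤N
  ... | 0 , refl = relabel
    (from-yes (Fin.all? λ i → (1 ∸ δ (# 3) i) + (1 ∸ δ (# 4) i) ℕ.≟ share 8 i)) (without (# 3) ⊕ without (# 4))
  ... | 1 , refl = relabel
    (from-yes (Fin.all? λ i → 1 + (1 ∸ δ (# 4) i) ℕ.≟ share 9 i)) (rainbow ⊕ without (# 4))
  ... | 2 , refl = relabel
    (from-yes (Fin.all? λ i → 2 ℕ.≟ share 10 i)) (rainbow ⊕ rainbow)
  ... | 3 , refl = contradiction refl N≢11
  ... | suc (suc (suc (suc o))) , refl = blocks-from-12 o

-- Passing from a balanced colouring of `G` to one of the corona.

BalancedColouring : Graph → Set
BalancedColouring G = Σ[ c ∈ (Graph.V G → Fin 5) ] IsProper G c × (∀ i → cnt c i (Graph.vertices G) ≡ share (Graph.order G) i)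

-- By balance each colour of `G` has as many vertices as the block lists fillings for it, so the
-- fillings can be handed out. Starting from total 0, they end at `N * s`, the order of the corona.
corona-balanced : ∀ {G H} (spl : Splitting H) → Blocks.Block H spl (Graph.order G) (share (Graph.order G)) →
                  BalancedColouring G → BalancedColouring (G ⊚ H)
corona-balanced {G} {H} spl blk (c , proper , sizes) with Blocks.fill blk 0
... | Λ , |Λ| , good , tot = col , (λ {x} {y} → col-proper x y) , col-sizes
  where
  us = Graph.vertices G
  N  = Graph.order G
  n  = Graph.order H
  open Blocks H spl using (Good; weight)
  D = distribute (Graph._≟ⱽ_ G) (vertices-! G) (λ _ → # 0) c Λ (λ i → trans (|Λ| i) (sym (sizes i)))
  β = proj₁ D
  β-good : ∀ u → Good (c u) (β u)
  β-good u = good (c u) (proj₁ (proj₂ D) (∈-vertices G u))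
  col : Graph.V (G ⊚ H) → Fin 5
  col (inj₁ u)       = c u
  col (inj₂ (u , a)) = β u a
  col-proper : ∀ x y → Graph._~_ (G ⊚ H) x y → col x ≢ col y
  col-proper (inj₁ u)       (inj₁ v)        u~v           = proper u~v
  col-proper (inj₁ u)       (inj₂ (.u , b)) refl          = proj₂ (β-good u) b ∘ sym
  col-proper (inj₂ (u , a)) (inj₁ .u)       refl          = proj₂ (β-good u) a
  col-proper (inj₂ (u , a)) (inj₂ (.u , b)) (refl , a~b)  = proj₁ (β-good u) a~b
  col-sizes : ∀ j → cnt col j (Graph.vertices (G ⊚ H)) ≡ share (Graph.order (G ⊚ H)) j
  col-sizes j = begin
    cnt col j (Graph.vertices (G ⊚ H))              ≡⟨ ∑-corona G H (λ x → δ (col x) j) ⟩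
    (∑[ u ∈ us ] δ (c u) j) + (∑[ u ∈ us ] cnt (β u) j (Graph.vertices H))
                                                    ≡⟨ ∑-+ us (λ u → δ (c u) j) _ ⟨
    ∑[ u ∈ us ] weight (c u) (β u) j                ≡⟨ proj₂ (proj₂ D) (λ i ψ → weight i ψ j) ⟩
    ∑[ i ∈ allFin 5 ] ∑[ ψ ∈ Λ i ] weight i ψ j     ≡⟨ tot j ⟩
    share (N * suc n + 0) j                         ≡⟨ cong (λ t → share t j) (trans (+-identityʳ _) (*-suc N n)) ⟩
    share (N + N * n) j                             ∎
    where open ≡-Reasoning

balanced⇒equitable : ∀ G → BalancedColouring G → EquitablyColorable G 5
balanced⇒equitable G (c , proper , sizes) = c , proper , λ i j →
  subst₂ (λ a b → ∣ a - b ∣ ≤ 1) (sym (size i)) (sym (size j)) (share-equitable (Graph.order G) i j)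
  where
  size : ∀ i → classSize G c i ≡ share (Graph.order G) i
  size i = trans (length-filter (λ v → c v Fin.≟ i) (Graph.vertices G)) (sizes i)

cubic⇒balanced : ∀ G → Cubic G → BalancedColouring G
cubic⇒balanced G cubic
  with balanced-colouring (Graph._≟ⱽ_ G) (Graph._~?_ G) (Graph.~-sym G) (Graph.~-irrefl G) (vertices-! G) (λ v → ≤-reflexive (cubic v))
... | c , proper , sizes = c , (λ {u} {v} → proper (∈-vertices G u) (∈-vertices G v)) ,
  λ i → trans (sizes i) (cong (λ m → share m i) (length-vertices G))

-- Parity of the order of a cubic graph.

module _ (G : Graph) where
  open Graph G using (_~_; _~?_; ~-sym; ~-irrefl; vertices; order)

  -- A new head counts its edges to the tail once in its row and once in its column; the diagonal
  -- entry is 0.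
  handshake : ∀ xs → ∃[ m ] ∑[ v ∈ xs ] ∑[ w ∈ xs ] ⟦ v ~? w ⟧ ≡ m * 2
  handshake []       = 0 , refl
  handshake (x ∷ xs) with handshake xs
  ... | m , e = d + m , (begin
    ⟦ x ~? x ⟧ + d + (∑[ v ∈ xs ] (⟦ v ~? x ⟧ + (∑[ w ∈ xs ] ⟦ v ~? w ⟧)))
      ≡⟨ cong₂ _+_ (cong (_+ d) (⟦⟧-false (x ~? x) ~-irrefl)) (∑-+ xs (λ v → ⟦ v ~? x ⟧) (λ v → ∑[ w ∈ xs ] ⟦ v ~? w ⟧)) ⟩
    d + ((∑[ v ∈ xs ] ⟦ v ~? x ⟧) + (∑[ v ∈ xs ] ∑[ w ∈ xs ] ⟦ v ~? w ⟧))
      ≡⟨ cong (d +_) (cong₂ _+_ (∑-cong xs λ {v} _ → ⟦⟧-cong ~-sym ~-sym (v ~? x) (x ~? v)) e) ⟩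
    d + (d + m * 2)
      ≡⟨ double d m ⟩
    (d + m) * 2 ∎)
    where
    open ≡-Reasoning
    d = ∑[ w ∈ xs ] ⟦ x ~? w ⟧
    double : ∀ d m → d + (d + m * 2) ≡ (d + m) * 2
    double = solve-∀

  -- The degree sum would be the odd number 33.
  cubic-order-≢11 : Cubic G → order ≢ 11
  cubic-order-≢11 cubic order≡11 = contradiction (begin
    33 % 2                                                  ≡⟨ cong (λ t → t * 3 % 2) order≡11 ⟨
    order * 3 % 2                                           ≡⟨ cong (λ t → t * 3 % 2) (length-vertices G) ⟨
    length vertices * 3 % 2                                 ≡⟨ cong (_% 2) (∑-const vertices 3) ⟨
    (∑[ v ∈ vertices ] 3) % 2                               ≡⟨ cong (_% 2) (∑-cong vertices λ {v} _ → trans (sym (length-filter (v ~?_) vertices)) (cubic v)) ⟨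
    (∑[ v ∈ vertices ] ∑[ w ∈ vertices ] ⟦ v ~? w ⟧) % 2    ≡⟨ cong (_% 2) (proj₂ (handshake vertices)) ⟩
    proj₁ (handshake vertices) * 2 % 2                      ≡⟨ m*n%n≡0 (proj₁ (handshake vertices)) 2 ⟩
    0                                                       ∎) λ ()
    where open ≡-Reasoning

  -- Decidability of equitable colourability, and least numbers of colours.

  module _ {k : ℕ} where

    Equitable : (Graph.V G → Fin k) → Set
    Equitable c = IsProper G c × (∀ i j → ∣ classSize G c i - classSize G c j ∣ ≤ 1)

    equitable? : ∀ c → Dec (Equitable c)
    equitable? c = Dec.map′
      (λ h {u} {v} → All.lookup (All.lookup h (∈-vertices G u)) (∈-vertices G v))
      (λ h → All.tabulate λ _ → All.tabulate λ _ → h)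
      (All.all? (λ u → All.all? (λ v → (u ~? v) →-dec ¬? (c u Fin.≟ c v)) vertices) vertices)
      ×-dec Fin.all? λ i → Fin.all? λ j → ∣ classSize G c i - classSize G c j ∣ ≤? 1

    -- A colouring is recovered from its finite code only pointwise, so equitability has to be
    -- carried along pointwise equality.
    equitable-resp : ∀ {c c′} → c ≗ c′ → Equitable c → Equitable c′
    equitable-resp {c} {c′} c≗c′ (proper , balanced) =
      (λ {u} {v} u~v e → proper u~v (trans (c≗c′ u) (trans e (sym (c≗c′ v))))) ,
      λ i j → subst₂ (λ a b → ∣ a - b ∣ ≤ 1) (size i) (size j) (balanced i j)
      where
      size : ∀ i → classSize G c i ≡ classSize G c′ i
      size i = trans (length-filter (λ v → c v Fin.≟ i) vertices)
        (trans (∑-cong vertices λ {v} _ → cong (λ l → δ l i) (c≗c′ v)) (sym (length-filter (λ v → c′ v Fin.≟ i) vertices)))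

  equitablyColorable? : ∀ k → Dec (EquitablyColorable G k)
  equitablyColorable? k = Dec.map′
    (λ (x , eq) → _ , eq)
    (λ (c , eq) → funToFin (c ∘ from) , equitable-resp (λ v → sym (trans (Fin.finToFun-funToFin (c ∘ from) (to v)) (cong c (strictlyInverseʳ v)))) eq)
    (Fin.any? λ x → equitable? (finToFun {k} {order} x ∘ to))
    where open Inverse (Graph.finite G) using (to; from; strictlyInverseʳ)

least : ∀ {P : ℕ → Set} → (∀ n → Dec (P n)) → ∀ {n} → P n → ∃[ k ] (IsLeast P k × k ≤ n)
least {P} P? {n} pn with search (suc n)
  where
  search : ∀ n → (∃[ k ] (IsLeast P k × k < n)) ⊎ (∀ j → j < n → ¬ P j)
  search zero    = inj₂ λ _ ()
  search (suc n) with search n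
  ... | inj₁ (k , l , k<n) = inj₁ (k , l , m<n⇒m<1+n k<n)
  ... | inj₂ none with P? n
  ...   | yes pn = inj₁ (n , (pn , λ j pj → ≮⇒≥ λ j<n → none j j<n pj) , ≤-refl)
  ...   | no ¬pn = inj₂ λ j j<1+n pj → case m≤n⇒m<n∨m≡n (s≤s⁻¹ j<1+n) of λ
    { (inj₁ j<n) → none j j<n pj ; (inj₂ refl) → ¬pn pj }
... | inj₁ (k , l , k<1+n) = k , l , s≤s⁻¹ k<1+n
... | inj₂ none            = contradiction pn (none n ≤-refl)

-- A graph without vertices is colourable with 0 colours.
order-positive : ∀ H {k} → IsChromaticNumber H (suc k) → 1 ≤ Graph.order H
order-positive H (_ , minimal) = n≢0⇒n>0 λ order≡0 →
  let empty : ¬ Graph.V H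
      empty v = Fin.¬Fin0 (subst Fin order≡0 (Inverse.to (Graph.finite H) v))
  in contradiction (minimal 0 ((λ v → contradiction v empty) , λ {u} → contradiction u empty)) λ ()

iterated-corona-balanced : ∀ G H (spl : Splitting H) → 1 ≤ Graph.order H → 8 ≤ Graph.order G → Graph.order G ≢ 11 →
                           BalancedColouring G → ∀ l → BalancedColouring (G ⊚^[ l ] H)
iterated-corona-balanced G H spl 1≤n 8≤N N≢11 bal l = proj₁ (go l)
  where
  -- The order bounds join the induction because the next corona needs a block decomposition of the
  -- current vertex set.
  go : ∀ l → BalancedColouring (G ⊚^[ l ] H) × 8 ≤ Graph.order (G ⊚^[ l ] H) × Graph.order (G ⊚^[ l ] H) ≢ 11
  go zero    = bal , 8≤N , N≢11
  go (suc l) with go l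
  ... | bal′ , 8≤M , M≢11 = corona-balanced spl (Blocks.blocks H spl 8≤M M≢11) bal′ ,
    ≤-trans (from-yes (8 ≤? 16)) 16≤ , λ e → contradiction (≤-trans 16≤ (≤-reflexive e)) (from-no (16 ≤? 11))
    where
    16≤ : 16 ≤ Graph.order (G ⊚^[ suc l ] H)
    16≤ = +-mono-≤ 8≤M (*-mono-≤ 8≤M 1≤n)

theorem3p6 : ∀ (G H : Graph) (l : ℕ) →
    Connected G → Cubic G → 8 ≤ Graph.order G →
    Q₃ H → 1 ≤ l →
    ∃[ k ] (IsEquitableChromaticNumber (G ⊚^[ l ] H) k × k ≤ 5)
theorem3p6 G H l _ cubic 8≤N (_ , _ , χ@(colorable , _)) _ =
  -- The equitable 5-colouring bounds a search by decidability, which produces the least number of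
  -- colours.
  least (equitablyColorable? (G ⊚^[ l ] H)) (balanced⇒equitable (G ⊚^[ l ] H) (iterated-corona-balanced G H (splitting H 1≤n colorable) 1≤n
    8≤N (cubic-order-≢11 G cubic) (cubic⇒balanced G cubic) l))
  where
  1≤n : 1 ≤ Graph.order H
  1≤n = order-positive H χ
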